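{- Let $T$ be a tournament. Then $T\in\mathcal{D}_5\setminus\mathcal{D}_3$ if and only if $T$ is switching equivalent to a transitive blowup of $L_6$.
   Context: A tournament is a directed graph with exactly one arc between each pair of distinct vertices; $u\rightarrow v$ means the arc goes from $u$ to $v$. For a tournament $T$ on vertices $v_1,\dots,v_n$, its skew-adjacency matrix is the $n\times n$ zero-diagonal matrix $S_T=[s_{ij}]$ with $s_{ij}=-s_{ji}=1$ if $v_i\rightarrow v_j$, and $\det(T):=\det(S_T)$. A subtournament of $T$ is the tournament $T[X]$ induced by a nonempty subset $X\subseteq V(T)$ (including $T$ itself). For a positive odd integer $k$, $\mathcal{D}_k$ is the set of tournaments all of whose subtournaments have determinant at most $k^2$. A tournament is transitive if it contains no directed 3-cycle. The switch of $T$ with respect to $W\subseteq V(T)$ is obtained by reversing all arcs between $W$ and $V(T)\setminus W$; two tournaments are switching equivalent if one is a switch of the other. For an $n$-tournament $R$ with vertices $v_1,\dots,v_n$ and positive integers $a_1,\dots,a_n$, the transitive blowup $R(a_1,\dots,a_n)$ is obtained by replacing each $v_i$ with a transitive tournament $T_i$ on $a_i$ vertices and putting $V(T_i)\rightarrow V(T_j)$ (all arcs from $V(T_i)$ to $V(T_j)$) whenever $v_i\rightarrow v_j$ in $R$. For $n\ge 2$, $L_n$ is the tournament on vertices $u_1,\dots,u_n$ with $u_i\rightarrow u_j$ for $1\le i<j\le n-1$, and for $1\le i\le n-1$: $u_n\rightarrow u_i$ if $i$ is odd and $u_i\rightarrow u_n$ if $i$ is even. A tournament "is $L_n$" if it is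 isomorphic to $L_n$. -}

module Defs where

open import Data.Bool using (Bool; true; false; not; if_then_else_; _xor_; _∧_)
open import Data.Nat as ℕ using (ℕ; zero; suc; _<ᵇ_; _≡ᵇ_; _%_)
open import Data.Fin as Fin using (Fin; toℕ; punchIn)
open import Data.Integer as ℤ using (ℤ; +_; -_; _*_; _+_)
open import Data.Product using (Σ; _,_)
open import Relation.Nullary using (does)
open import Relation.Binary.PropositionalEquality using (_≡_; _≢_)

-- Tournaments on a vertex type V, given by a Boolean arc relation:
-- arc u v ≡ true  means  u → v.

IsTournament : {V : Set} → (V → V → Bool) → Set
IsTournament {V} arc =
  (∀ v → arc v v ≡ false) × (∀ u v → u ≢ v → arc u v ≡ not (arc v u))
  where open import Data.Product using (_×_)

sumFin : ∀ n → (Fin n → ℤ) → ℤ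
sumFin zero    f = + 0
sumFin (suc n) f = f Fin.zero + sumFin n (λ i → f (Fin.suc i))

sign : ℕ → ℤ
sign k = if k % 2 ≡ᵇ 0 then + 1 else - (+ 1)

det : ∀ n → (Fin n → Fin n → ℤ) → ℤ
det zero    M = + 1
det (suc n) M = sumFin (suc n) λ j →
  sign (toℕ j) * M Fin.zero j * det n (λ a b → M (Fin.suc a) (punchIn j b))

skew : ∀ {n} → (Fin n → Fin n → Bool) → Fin n → Fin n → ℤ
skew arc i j = if arc i j then + 1 else (if arc j i then - (+ 1) else + 0)

-- Determinant of the subtournament induced by the image of an
-- order-preserving injection f : Fin m → Fin n (i.e. by a subset
-- of size m, listed in increasing order).
subDet : ∀ {n m} → (Fin n → Fin n → Bool) → (Fin m → Fin n) → ℤ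
subDet {m = m} arc f = det m (λ i j → skew arc (f i) (f j))

StrictlyIncreasing : ∀ {n m} → (Fin m → Fin n) → Set
StrictlyIncreasing f = ∀ i j → i Fin.< j → f i Fin.< f j

InD : ℕ → ∀ {n} → (Fin n → Fin n → Bool) → Set
InD k {n} arc = ∀ m (f : Fin (suc m) → Fin n) → StrictlyIncreasing f →
  subDet arc f ℤ.≤ + (k ℕ.* k)

switch : ∀ {V : Set} → (V → V → Bool) → (V → Bool) → V → V → Bool
switch arc W u v = if W u xor W v then arc v u else arc u v

-- L_n on vertices u_1 … u_n, here L (suc m) on Fin (suc m) with
-- u_{i+1} ↦ i.  For vertices other than the last, u_i → u_j iff i < j;
-- the last vertex u_n beats u_i for i odd (1-based), i.e. toℕ i even,
-- and loses to u_i for i even (1-based), i.e. toℕ i odd.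

isEven : ℕ → Bool
isEven k = k % 2 ≡ᵇ 0

L : ∀ m → Fin (suc m) → Fin (suc m) → Bool
L m i j =
  if toℕ i ≡ᵇ m then (not (toℕ j ≡ᵇ m) ∧ isEven (toℕ j))
  else (if toℕ j ≡ᵇ m then not (isEven (toℕ i)) else (toℕ i <ᵇ toℕ j))

L₆ : Fin 6 → Fin 6 → Bool
L₆ = L 5

BlowupV : ∀ {r} → (Fin r → ℕ) → Set
BlowupV {r} a = Σ (Fin r) (λ i → Fin (a i))

blowup : ∀ {r} → (Fin r → Fin r → Bool) → (a : Fin r → ℕ) →
         BlowupV a → BlowupV a → Bool
blowup R a (i , x) (j , y) =
  if does (i Fin.≟ j) then toℕ x <ᵇ toℕ y else R i j

open import Function.Bundles using (_↔_; Inverse)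

Isomorphic : ∀ {n} {V : Set} → (Fin n → Fin n → Bool) → (V → V → Bool) → Set
Isomorphic {n} {V} S R =
  Σ (Fin n ↔ V) λ φ → ∀ u v → S u v ≡ R (Inverse.to φ u) (Inverse.to φ v)

SwitchEquivBlowupL₆ : ∀ {n} → (Fin n → Fin n → Bool) → Set
SwitchEquivBlowupL₆ {n} arc =
  Σ (Fin n → Bool) λ W →
  Σ (Fin 6 → ℕ) λ a →
  (∀ i → 1 ℕ.≤ a i) ×' Isomorphic (switch arc W) (blowup L₆ a)
  where open import Data.Product using () renaming (_×_ to _×'_)

{-# OPTIONS --safe #-}
module Submission where

-- The determinant of a skew-adjacency matrix is unchanged by switching and by
-- deleting two twins x → y (vertices with the same arcs to all others), so every
-- subdeterminant of a switched transitive blowup of R equals one of R.  For L₆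
-- these are at most 25, and det L₆ = 25 > 9.
--
-- Conversely, let all subdeterminants of T be at most 25 and let T contain a
-- switched copy X of L₆.  Every vertex outside X looks to X like a twin of some
-- x_i, up to switching: otherwise X and the vertex contain a 6-subset of
-- determinant above 25.  Likewise two vertices of different types are joined as in L₆
-- (otherwise a subset of at most 8 vertices is too large), and a cyclic triangle
-- of vertices of the same type gives determinant 81 with three vertices of X.
-- Hence T is a switched blowup of L₆.  If T contains L₄ but not L₆, the same
-- argument makes T a switched blowup of L₄, and without L₄ it is switching
-- equivalent to a transitive tournament; in both cases T lies in D₃.

open import Defs
open import Data.Bool using (Bool; true; false; not; if_then_else_; _xor_)
import Data.Bool.Properties as 𝔹P
open import Data.Empty using (⊥; ⊥-elim)
open import Data.Fin as Fin using (Fin; zero; suc; toℕ; punchIn; punchOut; #_)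
import Data.Fin.Properties as FinP
open import Data.Integer as ℤ using (ℤ; +_; -_; _+_; _*_)
import Data.Integer.Properties as ℤP
open import Data.Integer.Tactic.RingSolver using (solve-∀)
open import Data.List as List using (List; []; _∷_; allFin; concatMap)
open import Data.List.Membership.Propositional using (_∈_)
open import Data.List.Membership.Propositional.Properties using (∈-map⁺; ∈-++⁺ˡ; ∈-++⁺ʳ)
open import Data.List.Relation.Unary.All as All using (All)
open import Data.List.Relation.Unary.Any as Any using (Any; here)
open import Data.Nat as ℕ using (ℕ; zero; suc; s≤s; z≤n)
import Data.Nat.Properties as ℕP
open import Data.Product using (Σ; ∃; _×_; _,_; proj₁; proj₂)
open import Data.Sum using (_⊎_; inj₁; inj₂)
open import Data.Vec as Vec using (Vec; []; _∷_; lookup; tabulate; removeAt)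
import Data.Vec.Properties as VecP
open import Function using (_∘_; flip; _on_)
open import Function.Bundles using (_⇔_; mk⇔; mk↔ₛ′; Inverse)
open import Function.Definitions using (Injective)
open import Relation.Binary.Definitions using (tri<; tri≈; tri>)
open import Relation.Binary.PropositionalEquality
open import Relation.Nullary using (¬_; Dec; yes; no; does; contradiction)
open import Relation.Nullary.Decidable using (dec-true; dec-false; _×-dec_; _⊎-dec_; _→-dec_; ¬?; map′; from-yes)
open import Relation.Unary using (Decidable)

open ≡-Reasoning

-- Determinants

Matrix : ℕ → Set
Matrix n = Fin n → Fin n → ℤ

sum-cong : ∀ n {f g : Fin n → ℤ} → (∀ i → f i ≡ g i) → sumFin n f ≡ sumFin n g
sum-cong zero    p = refl
sum-cong (suc n) p = cong₂ _+_ (p zero) (sum-cong n (p ∘ suc))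

sum-zero : ∀ n {f : Fin n → ℤ} → (∀ i → f i ≡ + 0) → sumFin n f ≡ + 0
sum-zero zero    p = refl
sum-zero (suc n) p rewrite p zero | sum-zero n (p ∘ suc) = refl

sum-+ : ∀ n (f g : Fin n → ℤ) → sumFin n (λ i → f i + g i) ≡ sumFin n f + sumFin n g
sum-+ zero    f g = refl
sum-+ (suc n) f g rewrite sum-+ n (f ∘ suc) (g ∘ suc) =
  interchange (f zero) (g zero) (sumFin n (f ∘ suc)) (sumFin n (g ∘ suc))
  where
  interchange : ∀ a b c d → (a + b) + (c + d) ≡ (a + c) + (b + d)
  interchange = solve-∀

sum-* : ∀ n c (f : Fin n → ℤ) → sumFin n (λ i → c * f i) ≡ c * sumFin n f
sum-* zero    c f = sym (ℤP.*-zeroʳ c)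
sum-* (suc n) c f rewrite sum-* n c (f ∘ suc) = sym (ℤP.*-distribˡ-+ c _ _)

sum-neg : ∀ n (f : Fin n → ℤ) → sumFin n (λ i → - f i) ≡ - sumFin n f
sum-neg zero    f = refl
sum-neg (suc n) f rewrite sum-neg n (f ∘ suc) = sym (ℤP.neg-distrib-+ (f zero) _)

sum-swap : ∀ m n (f : Fin m → Fin n → ℤ) →
  sumFin m (λ i → sumFin n (f i)) ≡ sumFin n (λ j → sumFin m (λ i → f i j))
sum-swap zero    n f = sym (sum-zero n (λ _ → refl))
sum-swap (suc m) n f = trans (cong (λ s → sumFin n (f zero) + s) (sum-swap m n (f ∘ suc)))
  (sym (sum-+ n (f zero) (λ j → sumFin m (λ i → f (suc i) j))))

sign-suc : ∀ k → sign (suc k) ≡ - sign k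
sign-suc zero          = refl
sign-suc (suc zero)    = refl
sign-suc (suc (suc k)) = sign-suc k

sign² : ∀ k → sign k * sign k ≡ + 1
sign² zero          = refl
sign² (suc zero)    = refl
sign² (suc (suc k)) = sign² k

det-cong : ∀ n {M N : Matrix n} → (∀ i j → M i j ≡ N i j) → det n M ≡ det n N
det-cong zero    p = refl
det-cong (suc n) p = sum-cong (suc n) λ j →
  cong₂ (λ x y → sign (toℕ j) * x * y) (p zero j)
        (det-cong n (λ a b → p (suc a) (punchIn j b)))

-- Induction: each minor of the row expansion is expanded down its first column, the two sums are
-- swapped and the factors regrouped. The term of the corner entry is common to both expansions.
det-expand-column : ∀ n (M : Matrix (suc n)) → det (suc n) M ≡
  sumFin (suc n) λ i → sign (toℕ i) * M i zero * det n (λ a b → M (punchIn i a) (suc b))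
det-expand-column zero    M = refl
det-expand-column (suc n) M = cong (λ s → sign 0 * M zero zero * det (suc n) (λ a b → M (suc a) (suc b)) + s) (begin
  sumFin (suc n) (λ j → sign (suc (toℕ j)) * r j * det (suc n) (λ a b → M (suc a) (punchIn (suc j) b)))
    ≡⟨ sum-cong (suc n) (λ j → cong (sign (suc (toℕ j)) * r j *_)
         (det-expand-column n (λ a b → M (suc a) (punchIn (suc j) b)))) ⟩
  sumFin (suc n) (λ j → sign (suc (toℕ j)) * r j * sumFin (suc n) (λ i → sign (toℕ i) * c i * D i j))
    ≡⟨ sum-cong (suc n) (λ j → sym (sum-* (suc n) (sign (suc (toℕ j)) * r j) (λ i → sign (toℕ i) * c i * D i j))) ⟩
  sumFin (suc n) (λ j → sumFin (suc n) (λ i → (sign (suc (toℕ j)) * r j) * (sign (toℕ i) * c i * D i j)))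
    ≡⟨ sum-swap (suc n) (suc n) (λ j i → (sign (suc (toℕ j)) * r j) * (sign (toℕ i) * c i * D i j)) ⟩
  sumFin (suc n) (λ i → sumFin (suc n) (λ j → (sign (suc (toℕ j)) * r j) * (sign (toℕ i) * c i * D i j)))
    ≡⟨ sum-cong (suc n) (λ i → sum-cong (suc n) (λ j → exchange i j)) ⟩
  sumFin (suc n) (λ i → sumFin (suc n) (λ j → (sign (suc (toℕ i)) * c i) * (sign (toℕ j) * r j * D i j)))
    ≡⟨ sum-cong (suc n) (λ i → sum-* (suc n) (sign (suc (toℕ i)) * c i) (λ j → sign (toℕ j) * r j * D i j)) ⟩
  sumFin (suc n) (λ i → sign (suc (toℕ i)) * c i * sumFin (suc n) (λ j → sign (toℕ j) * r j * D i j)) ∎)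
  where
  r c : Fin (suc n) → ℤ
  r j = M zero (suc j)
  c i = M (suc i) zero
  D : Fin (suc n) → Fin (suc n) → ℤ
  D i j = det n (λ a b → M (suc (punchIn i a)) (suc (punchIn j b)))
  ring : ∀ s t x y d → (- s * x) * (t * y * d) ≡ (- t * y) * (s * x * d)
  ring = solve-∀
  exchange : ∀ i j → (sign (suc (toℕ j)) * r j) * (sign (toℕ i) * c i * D i j)
                   ≡ (sign (suc (toℕ i)) * c i) * (sign (toℕ j) * r j * D i j)
  exchange i j rewrite sign-suc (toℕ j) | sign-suc (toℕ i) =
    ring (sign (toℕ j)) (sign (toℕ i)) (r j) (c i) (D i j)

-- The row expansion of the transpose is the column expansion of `M`, once the minors are transposed
-- by induction.
det-transpose : ∀ n (M : Matrix n) → det n (flip M) ≡ det n M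
det-transpose zero    M = refl
det-transpose (suc n) M = trans
  (sum-cong (suc n) λ j → cong (sign (toℕ j) * M j zero *_)
    (det-transpose n (λ a b → M (punchIn j a) (suc b))))
  (sym (det-expand-column n M))

-- Permutations of rows and columns

swap₀₁ : ∀ {n} → Fin (suc (suc n)) → Fin (suc (suc n))
swap₀₁ zero          = suc zero
swap₀₁ (suc zero)    = zero
swap₀₁ (suc (suc i)) = suc (suc i)

swap₀₁-punchIn : ∀ {n} (j : Fin (suc n)) (b : Fin (suc (suc n))) →
  swap₀₁ (punchIn (suc (suc j)) b) ≡ punchIn (suc (suc j)) (swap₀₁ b)
swap₀₁-punchIn j zero          = refl
swap₀₁-punchIn j (suc zero)    = refl
swap₀₁-punchIn j (suc (suc b)) = refl

-- The first two terms of the expansion trade places and so change sign; every other minor still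
-- contains both swapped columns and is negated by induction.
det-swap-columns : ∀ n (M : Matrix (suc (suc n))) →
  det (suc (suc n)) (λ i j → M i (swap₀₁ j)) ≡ - det (suc (suc n)) M
det-swap-columns n M = begin
  sign 0 * x₁ * det (suc n) (λ a b → M (suc a) (swap₀₁ (suc b)))
    + (sign 1 * x₀ * det (suc n) (λ a b → M (suc a) (swap₀₁ (punchIn (suc zero) b))) + S)
    ≡⟨ cong₂ (λ p q → sign 0 * x₁ * p + (sign 1 * x₀ * q + S))
         (det-cong (suc n) {λ a b → M (suc a) (swap₀₁ (suc b))} {λ a b → M (suc a) (punchIn (suc zero) b)}
           (λ { a zero → refl ; a (suc b) → refl }))
         (det-cong (suc n) {λ a b → M (suc a) (swap₀₁ (punchIn (suc zero) b))} {λ a b → M (suc a) (suc b)}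
           (λ { a zero → refl ; a (suc b) → refl })) ⟩
  sign 0 * x₁ * D₁ + (sign 1 * x₀ * D₀ + S)
    ≡⟨ cong (λ p → sign 0 * x₁ * D₁ + (sign 1 * x₀ * D₀ + p)) (tail n M) ⟩
  sign 0 * x₁ * D₁ + (sign 1 * x₀ * D₀ + - R)
    ≡⟨ ring x₀ x₁ D₀ D₁ R ⟩
  - (sign 0 * x₀ * D₀ + (sign 1 * x₁ * D₁ + R)) ∎
  where
  x₀ = M zero zero
  x₁ = M zero (suc zero)
  D₀ = det (suc n) (λ a b → M (suc a) (suc b))
  D₁ = det (suc n) (λ a b → M (suc a) (punchIn (suc zero) b))
  S = sumFin n (λ j → sign (toℕ j) * M zero (suc (suc j)) *
        det (suc n) (λ a b → M (suc a) (swap₀₁ (punchIn (suc (suc j)) b))))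
  R = sumFin n (λ j → sign (toℕ j) * M zero (suc (suc j)) *
        det (suc n) (λ a b → M (suc a) (punchIn (suc (suc j)) b)))
  ring : ∀ x y p q r → + 1 * y * q + (- (+ 1) * x * p + - r) ≡ - (+ 1 * x * p + (- (+ 1) * y * q + r))
  ring = solve-∀
  neg-right : ∀ s d → s * - d ≡ - (s * d)
  neg-right s d = sym (ℤP.neg-distribʳ-* s d)
  -- The induction hypothesis needs minors with at least two columns, so the empty sum is split off
  -- first.
  tail : ∀ n (M : Matrix (suc (suc n))) →
    sumFin n (λ j → sign (toℕ j) * M zero (suc (suc j)) *
        det (suc n) (λ a b → M (suc a) (swap₀₁ (punchIn (suc (suc j)) b))))
    ≡ - sumFin n (λ j → sign (toℕ j) * M zero (suc (suc j)) *
        det (suc n) (λ a b → M (suc a) (punchIn (suc (suc j)) b)))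
  tail zero    M = refl
  tail (suc n) M = trans
    (sum-cong (suc n) λ j → trans
      (cong (sign (toℕ j) * M zero (suc (suc j)) *_) (trans
        (det-cong (suc (suc n)) (λ a b → cong (M (suc a)) (swap₀₁-punchIn j b)))
        (det-swap-columns n (λ a b → M (suc a) (punchIn (suc (suc j)) b)))))
      (neg-right (sign (toℕ j) * M zero (suc (suc j))) _))
    (sum-neg (suc n) (λ j → sign (toℕ j) * M zero (suc (suc j)) *
      det (suc (suc n)) (λ a b → M (suc a) (punchIn (suc (suc j)) b))))

det-swap-rows : ∀ n (M : Matrix (suc (suc n))) →
  det (suc (suc n)) (λ i j → M (swap₀₁ i) j) ≡ - det (suc (suc n)) M
det-swap-rows n M = trans (sym (det-transpose _ (λ i j → M (swap₀₁ i) j)))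
  (trans (det-swap-columns n (flip M)) (cong -_ (det-transpose _ M)))

-- A record, so that type checking does not unfold determinants of size suc n.
record Signed {n} (ρ : Fin n → Fin n) : Set where
  constructor signed
  field
    sgn  : ℤ
    sgn² : sgn * sgn ≡ + 1
    rows : ∀ (M : Matrix n) → det n (λ i j → M (ρ i) j) ≡ sgn * det n M

-- Rows and columns contribute the factor `sgn` once each, and its square is 1.
det-reindex : ∀ {n} {ρ : Fin n → Fin n} → Signed ρ → (M : Matrix n) →
  det n (λ i j → M (ρ i) (ρ j)) ≡ det n M
det-reindex {n} {ρ} (signed ε ε² s) M = begin
  det n (λ i j → M (ρ i) (ρ j))      ≡⟨ s (λ i j → M i (ρ j)) ⟩
  ε * det n (λ i j → M i (ρ j))      ≡⟨ cong (ε *_) (sym (det-transpose n (λ i j → M i (ρ j)))) ⟩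
  ε * det n (λ i j → M j (ρ i))      ≡⟨ cong (ε *_) (s (flip M)) ⟩
  ε * (ε * det n (flip M))           ≡⟨ sym (ℤP.*-assoc ε ε _) ⟩
  ε * ε * det n (flip M)             ≡⟨ cong₂ _*_ ε² (det-transpose n M) ⟩
  + 1 * det n M                      ≡⟨ ℤP.*-identityˡ _ ⟩
  det n M                            ∎

lift : ∀ {n} → (Fin n → Fin n) → Fin (suc n) → Fin (suc n)
lift ρ zero    = zero
lift ρ (suc i) = suc (ρ i)

toFront : ∀ {n} → Fin (suc n) → Fin (suc n) → Fin (suc n)
toFront k zero    = k
toFront k (suc i) = punchIn k i

-- Keeps with-abstraction from normalising these proofs.
abstract
  signed-id : ∀ {n} → Signed {n} (λ i → i)
  signed-id = signed (+ 1) refl λ M → sym (ℤP.*-identityˡ _)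

  signed-∘ : ∀ {n} {ρ σ : Fin n → Fin n} → Signed ρ → Signed σ → Signed (ρ ∘ σ)
  signed-∘ {n} {ρ} (signed ε ε² s) (signed δ δ² t) = signed (δ * ε) square λ M →
    trans (t (λ i j → M (ρ i) j)) (trans (cong (δ *_) (s M)) (sym (ℤP.*-assoc δ ε _)))
    where
    ring : ∀ x y → x * y * (x * y) ≡ x * x * (y * y)
    ring = solve-∀
    square : δ * ε * (δ * ε) ≡ + 1
    square = trans (ring δ ε) (cong₂ _*_ δ² ε²)

  signed-lift : ∀ {n} {ρ : Fin n → Fin n} → Signed ρ → Signed (lift ρ)
  signed-lift {n} {ρ} (signed ε ε² s) = signed ε ε² λ M → trans
    (sum-cong (suc n) λ j → trans
      (cong (sign (toℕ j) * M zero j *_) (s (λ a b → M (suc a) (punchIn j b))))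
      (ring (sign (toℕ j)) (M zero j) ε _))
    (sum-* (suc n) ε (λ j → sign (toℕ j) * M zero j * det n (λ a b → M (suc a) (punchIn j b))))
    where
    ring : ∀ a b c d → a * b * (c * d) ≡ c * (a * b * d)
    ring = solve-∀

  signed-cong : ∀ {n} {ρ σ : Fin n → Fin n} → (∀ i → ρ i ≡ σ i) → Signed ρ → Signed σ
  signed-cong {n} {ρ} {σ} p (signed ε ε² s) = signed ε ε² λ M → trans
    (det-cong n {λ i j → M (σ i) j} {λ i j → M (ρ i) j} (λ i j → cong (λ v → M v j) (sym (p i))))
    (s M)

  signed-swap₀₁ : ∀ {n} → Signed {suc (suc n)} swap₀₁
  signed-swap₀₁ {n} = signed (- (+ 1)) refl λ M →
    trans (det-swap-rows n M) (sym (ℤP.-1*i≡-i (det (suc (suc n)) M)))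

  signed-toFront : ∀ {n} (k : Fin (suc n)) → Signed (toFront k)
  signed-toFront {n} zero = signed-cong {ρ = λ i → i} {σ = toFront zero}
    (λ { zero → refl ; (suc i) → refl }) signed-id
  signed-toFront {suc n} (suc k) = signed-cong {ρ = lift (toFront k) ∘ swap₀₁} {σ = toFront (suc k)}
    (λ { zero → refl ; (suc zero) → refl ; (suc (suc i)) → refl })
    (signed-∘ {ρ = lift (toFront k)} {σ = swap₀₁}
      (signed-lift {ρ = toFront k} (signed-toFront k)) signed-swap₀₁)

-- The witness `p` is the product of the entries of `d`; later arguments see it only through these
-- two properties.
det-scale-rows : ∀ n (d : Fin n → ℤ) → Σ ℤ λ p →
  ((∀ i → d i * d i ≡ + 1) → p * p ≡ + 1) ×
  (∀ M → det n (λ i j → d i * M i j) ≡ p * det n M)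
det-scale-rows zero    d = + 1 , (λ _ → refl) , λ M → refl
det-scale-rows (suc n) d with det-scale-rows n (d ∘ suc)
... | p , p² , s = d zero * p , square , λ M → trans
  (sum-cong (suc n) λ j → trans
    (cong (sign (toℕ j) * (d zero * M zero j) *_) (s (λ a b → M (suc a) (punchIn j b))))
    (ring (sign (toℕ j)) (d zero) (M zero j) p _))
  (sum-* (suc n) (d zero * p) (λ j → sign (toℕ j) * M zero j * det n (λ a b → M (suc a) (punchIn j b))))
  where
  ring : ∀ a b c q e → a * (b * c) * (q * e) ≡ b * q * (a * c * e)
  ring = solve-∀
  ring₂ : ∀ x y → x * y * (x * y) ≡ x * x * (y * y)
  ring₂ = solve-∀
  square : (∀ i → d i * d i ≡ + 1) → d zero * p * (d zero * p) ≡ + 1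
  square d² = trans (ring₂ (d zero) p) (cong₂ _*_ (d² zero) (p² (d² ∘ suc)))

-- Conjugation by a diagonal matrix of signs, which is the effect of switching: `p` enters once for
-- the rows and once for the columns.
det-conjugate : ∀ n (d : Fin n → ℤ) → (∀ i → d i * d i ≡ + 1) → (M : Matrix n) →
  det n (λ i j → d i * (d j * M i j)) ≡ det n M
det-conjugate n d d² M with det-scale-rows n d
... | p , p² , s = begin
  det n (λ i j → d i * (d j * M i j))  ≡⟨ s (λ i j → d j * M i j) ⟩
  p * det n (λ i j → d j * M i j)      ≡⟨ cong (p *_) (sym (det-transpose n (λ i j → d j * M i j))) ⟩
  p * det n (λ i j → d i * M j i)      ≡⟨ cong (p *_) (s (flip M)) ⟩
  p * (p * det n (flip M))             ≡⟨ sym (ℤP.*-assoc p p _) ⟩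
  p * p * det n (flip M)               ≡⟨ cong₂ _*_ (p² d²) (det-transpose n M) ⟩
  + 1 * det n M                        ≡⟨ ℤP.*-identityˡ _ ⟩
  det n M                              ∎

self-neg⇒0 : ∀ x → x ≡ - x → x ≡ + 0
self-neg⇒0 (+ zero) _ = refl

-- Row 0 is row 1 plus the row (1, 1, 0, ..., 0). With row 1 in place of row 0 the matrix is
-- singular, and the other summand expands to `D₀ + - D₁`, two minors that differ in a single entry.
det-twins : ∀ n (M : Matrix (suc (suc n))) →
  M zero zero ≡ + 0 → M (suc zero) (suc zero) ≡ + 0 →
  M zero (suc zero) ≡ + 1 → M (suc zero) zero ≡ - (+ 1) →
  (∀ j → M zero (suc (suc j)) ≡ M (suc zero) (suc (suc j))) →
  (∀ j → M (suc (suc j)) zero ≡ M (suc (suc j)) (suc zero)) →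
  det (suc (suc n)) M ≡ det n (λ a b → M (suc (suc a)) (suc (suc b)))
det-twins n M m₀₀ m₁₁ m₀₁ m₁₀ row col = begin
  det (suc (suc n)) M
    ≡⟨ cong₂ (λ x y → + 1 * x * D₀ + (- (+ 1) * y * D₁ + R)) m₀₀ m₀₁ ⟩
  + 1 * + 0 * D₀ + (- (+ 1) * + 1 * D₁ + R)
    ≡⟨ ring₁ D₀ D₁ R ⟩
  (+ 1 * - (+ 1) * D₀ + (- (+ 1) * + 0 * D₁ + R)) + (D₀ + - D₁)
    ≡⟨ cong₂ _+_ repeated difference ⟩
  + 0 + det n B
    ≡⟨ ℤP.+-identityˡ _ ⟩
  det n B ∎
  where
  B : Matrix n
  B a b = M (suc (suc a)) (suc (suc b))
  D₀ = det (suc n) (λ a b → M (suc a) (suc b))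
  D₁ = det (suc n) (λ a b → M (suc a) (punchIn (suc zero) b))
  R = sumFin n (λ j → sign (toℕ j) * M zero (suc (suc j)) *
        det (suc n) (λ a b → M (suc a) (punchIn (suc (suc j)) b)))
  ring₁ : ∀ p q r → + 1 * + 0 * p + (- (+ 1) * + 1 * q + r)
                  ≡ (+ 1 * - (+ 1) * p + (- (+ 1) * + 0 * q + r)) + (p + - q)
  ring₁ = solve-∀
  repeat : ∀ {n} → Fin (suc (suc n)) → Fin (suc (suc n))
  repeat zero    = suc zero
  repeat (suc i) = suc i
  N : Matrix (suc (suc n))
  N i j = M (repeat i) j
  -- The first two rows of `N` agree, so swapping them both fixes and negates its determinant.
  N-singular : det (suc (suc n)) N ≡ + 0
  N-singular = self-neg⇒0 _ (trans
    (det-cong (suc (suc n)) {N} {λ i j → N (swap₀₁ i) j}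
      (λ { zero j → refl ; (suc zero) j → refl ; (suc (suc i)) j → refl }))
    (det-swap-rows n N))
  repeated : + 1 * - (+ 1) * D₀ + (- (+ 1) * + 0 * D₁ + R) ≡ + 0
  repeated = trans
    (cong₂ (λ x y → + 1 * x * D₀ + y) (sym m₁₀)
      (cong₂ (λ x y → - (+ 1) * x * D₁ + y) (sym m₁₁)
        (sum-cong n (λ j → cong (λ x → sign (toℕ j) * x *
          det (suc n) (λ a b → M (suc a) (punchIn (suc (suc j)) b))) (row j)))))
    N-singular
  D₁-tail : ℤ
  D₁-tail = sumFin n (λ j → sign (suc (toℕ j)) * M (suc zero) (suc (suc j)) *
      det n (λ a b → M (suc (suc a)) (punchIn (suc zero) (punchIn (suc j) b))))
  ring₂ : ∀ p r → + 1 * + 0 * p + r + - (+ 1 * - (+ 1) * p + r) ≡ p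
  ring₂ = solve-∀
  tails : ∀ n (M : Matrix (suc (suc n))) →
    (∀ j → M (suc (suc j)) zero ≡ M (suc (suc j)) (suc zero)) →
    sumFin n (λ j → sign (suc (toℕ j)) * M (suc zero) (suc (suc j)) *
      det n (λ a b → M (suc (suc a)) (suc (punchIn (suc j) b))))
    ≡ sumFin n (λ j → sign (suc (toℕ j)) * M (suc zero) (suc (suc j)) *
      det n (λ a b → M (suc (suc a)) (punchIn (suc zero) (punchIn (suc j) b))))
  tails zero    M col = refl
  tails (suc n) M col = sum-cong (suc n) λ j →
    cong (sign (suc (toℕ j)) * M (suc zero) (suc (suc j)) *_)
      (det-cong (suc n) {λ a b → M (suc (suc a)) (suc (punchIn (suc j) b))}
        {λ a b → M (suc (suc a)) (punchIn (suc zero) (punchIn (suc j) b))}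
        (λ { a zero → sym (col a) ; a (suc b) → refl }))
  -- Below row 1 the columns 0 and 1 coincide, so the two minors differ only in their corner, 0
  -- against -1, and one copy of `det n B` survives.
  difference : D₀ + - D₁ ≡ det n B
  difference = trans
    (cong₂ (λ x y → x + - y)
      (cong₂ (λ x y → + 1 * x * det n B + y) m₁₁ (tails n M col))
      (cong (λ x → + 1 * x * det n B + D₁-tail) m₁₀))
    (ring₂ (det n B) D₁-tail)

-- Tournaments, switching and sorting

Arcs : ℕ → Set
Arcs n = Fin n → Fin n → Bool

Inj : ∀ {A B : Set} → (A → B) → Set
Inj = Injective _≡_ _≡_

false≢true : ∀ {b} → b ≡ false → b ≡ true → ⊥
false≢true refl ()

does-sound : ∀ {P : Set} (d : Dec P) → does d ≡ true → P
does-sound (yes p) _ = p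

asym : ∀ {n} {T : Arcs n} → IsTournament T → ∀ {u v} → T u v ≡ true → T v u ≡ false
asym (irr , anti) {u} {v} uv with u Fin.≟ v
... | yes refl = ⊥-elim (false≢true (irr u) uv)
... | no u≢v   = trans (anti v u (u≢v ∘ sym)) (cong not uv)

tournament-on : ∀ {V : Set} {m} {T : V → V → Bool} {f : Fin m → V} → Inj f →
  IsTournament T → IsTournament (T on f)
tournament-on {f = f} inj (irr , anti) =
  (λ v → irr (f v)) , λ u v u≢v → anti (f u) (f v) (u≢v ∘ inj)

switch-tournament : ∀ {n} {T : Arcs n} (W : Fin n → Bool) → IsTournament T → IsTournament (switch T W)
switch-tournament {T = T} W (irr , anti) = irr′ , anti′
  where
  irr′ : ∀ v → switch T W v v ≡ false
  irr′ v with W v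
  ... | true  = irr v
  ... | false = irr v
  anti′ : ∀ u v → u ≢ v → switch T W u v ≡ not (switch T W v u)
  anti′ u v u≢v with W u | W v
  ... | true  | true  = anti u v u≢v
  ... | true  | false = anti v u (u≢v ∘ sym)
  ... | false | true  = anti v u (u≢v ∘ sym)
  ... | false | false = anti u v u≢v

switch-switch : ∀ {V : Set} (T : V → V → Bool) (W W′ : V → Bool) u v →
  switch (switch T W) W′ u v ≡ switch T (λ x → W x xor W′ x) u v
switch-switch T W W′ u v with W u | W v | W′ u | W′ v
... | true  | true  | true  | true  = refl
... | true  | true  | true  | false = refl
... | true  | true  | false | true  = refl
... | true  | true  | false | false = refl
... | true  | false | true  | true  = refl
... | true  | false | true  | false = refl
... | true  | false | false | true  = refl
... | true  | false | false | false = refl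
... | false | true  | true  | true  = refl
... | false | true  | true  | false = refl
... | false | true  | false | true  = refl
... | false | true  | false | false = refl
... | false | false | true  | true  = refl
... | false | false | true  | false = refl
... | false | false | false | true  = refl
... | false | false | false | false = refl

skew-cong : ∀ {m n} {S : Arcs m} {T : Arcs n} {a b c d} →
  S a b ≡ T c d → S b a ≡ T d c → skew S a b ≡ skew T c d
skew-cong p q rewrite p | q = refl

ε : Bool → ℤ
ε b = if b then - (+ 1) else + 1

ε² : ∀ b → ε b * ε b ≡ + 1
ε² true  = refl
ε² false = refl

skew-switch : ∀ {n} {T : Arcs n} (W : Fin n → Bool) → IsTournament T → ∀ u v →
  skew (switch T W) u v ≡ ε (W u) * (ε (W v) * skew T u v)
skew-switch {T = T} W t u v with W u | W v | T u v in uv | T v u in vu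
... | _     | _     | true  | true  = ⊥-elim (false≢true (asym t uv) vu)
... | true  | true  | true  | false = refl
... | true  | false | true  | false = refl
... | false | true  | true  | false = refl
... | false | false | true  | false = refl
... | true  | true  | false | true  = refl
... | true  | false | false | true  = refl
... | false | true  | false | true  = refl
... | false | false | false | true  = refl
... | true  | true  | false | false = refl
... | true  | false | false | false = refl
... | false | true  | false | false = refl
... | false | false | false | false = refl

-- Switching multiplies the entry at `u`, `v` by `ε (W u)` and `ε (W v)`, a conjugation by diagonal
-- signs.
subDet-switch : ∀ {n m} {T : Arcs n} (W : Fin n → Bool) → IsTournament T →
  (f : Fin m → Fin n) → subDet (switch T W) f ≡ subDet T f
subDet-switch {m = m} {T} W t f = trans
  (det-cong m {N = λ i j → ε (W (f i)) * (ε (W (f j)) * skew T (f i) (f j))}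
    (λ i j → skew-switch W t (f i) (f j)))
  (det-conjugate m (ε ∘ W ∘ f) (ε² ∘ W ∘ f) (λ i j → skew T (f i) (f j)))

-- Sorting transitive tournaments

TransitiveOn : ∀ {n} → (Fin n → Bool) → Arcs n → Set
TransitiveOn P lt = ∀ i j k → P i ≡ true → P j ≡ true → P k ≡ true →
  lt i j ≡ true → lt j k ≡ true → lt i k ≡ true

-- Induction: vertex 0 is compared with a source of the rest. If it wins, transitivity lets it beat
-- whatever that source beats.
source : ∀ n (lt : Arcs n) (P : Fin n → Bool) → IsTournament lt → TransitiveOn P lt →
  (∀ i → P i ≡ false) ⊎
  Σ (Fin n) λ i → P i ≡ true × (∀ j → P j ≡ true → j ≢ i → lt i j ≡ true)
source zero    lt P t tr = inj₁ λ ()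
source (suc n) lt P t tr
  with P zero in p₀ | source n (lt on suc) (P ∘ suc) (tournament-on FinP.suc-injective t)
                        (λ i j k → tr (suc i) (suc j) (suc k))
... | false | inj₁ none = inj₁ λ { zero → p₀ ; (suc i) → none i }
... | true  | inj₁ none = inj₂ (zero , p₀ ,
  λ { zero _ j≢ → contradiction refl j≢ ; (suc j) pj _ → ⊥-elim (false≢true (none j) pj) })
... | false | inj₂ (k , pk , s) = inj₂ (suc k , pk ,
  λ { zero pj _ → ⊥-elim (false≢true p₀ pj) ; (suc j) pj j≢ → s j pj (j≢ ∘ cong suc) })
... | true  | inj₂ (k , pk , s) with lt zero (suc k) in e
...   | false = inj₂ (suc k , pk ,
  λ { zero _ _ → trans (proj₂ t (suc k) zero (λ ())) (cong not e)
    ; (suc j) pj j≢ → s j pj (j≢ ∘ cong suc) })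
...   | true  = inj₂ (zero , p₀ , beats)
  where
  beats : ∀ j → P j ≡ true → j ≢ zero → lt zero j ≡ true
  beats zero    _  j≢ = contradiction refl j≢
  beats (suc j) pj _ with j Fin.≟ k
  ... | yes refl = e
  ... | no j≢k   = tr zero (suc k) (suc j) p₀ pk pj e (s j pj j≢k)

toFront-punchOut : ∀ {n} {k i : Fin (suc n)} (k≢i : k ≢ i) → toFront k (suc (punchOut k≢i)) ≡ i
toFront-punchOut k≢i = FinP.punchIn-punchOut k≢i

-- Selection sort by successive sources. The permutation is composed of `toFront` moves, which makes
-- it `Signed` by construction. The same procedure sorts vertex lists and orders transitive blocks.
sort : ∀ n (lt : Arcs n) → IsTournament lt → TransitiveOn (λ _ → true) lt →
  Σ (Fin n → Fin n) λ ρ → Signed ρ × (∀ i → ∃ λ k → ρ k ≡ i) ×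
  (∀ i j → i Fin.< j → lt (ρ i) (ρ j) ≡ true)
sort zero    lt t tr = (λ i → i) , signed-id , (λ ()) , λ ()
sort (suc n) lt t tr with source (suc n) lt (λ _ → true) t tr
... | inj₁ none with () ← none zero
... | inj₂ (k , _ , least)
  with sort n (lt on punchIn k) (tournament-on (FinP.punchIn-injective k _ _) t)
         (λ i j l → tr (punchIn k i) (punchIn k j) (punchIn k l))
...   | σ , signed-σ , surj , incr =
  toFront k ∘ lift σ ,
  signed-∘ {ρ = toFront k} {σ = lift σ} (signed-toFront k) (signed-lift {ρ = σ} signed-σ) ,
  onto , increasing
  where
  onto : ∀ i → ∃ λ l → toFront k (lift σ l) ≡ i
  onto i with k Fin.≟ i
  ... | yes refl = zero , refl
  ... | no k≢i with surj (punchOut k≢i)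
  ...   | l , eq = suc l , trans (cong (punchIn k) eq) (toFront-punchOut k≢i)
  increasing : ∀ i j → i Fin.< j → lt (toFront k (lift σ i)) (toFront k (lift σ j)) ≡ true
  increasing zero    (suc j) _         = least (punchIn k (σ j)) refl (FinP.punchInᵢ≢i k (σ j))
  increasing (suc i) (suc j) (s≤s i<j) = incr i j i<j

-- The order of the values of `f` is read as a transitive tournament on the positions.
sort-increasing : ∀ {m n} (f : Fin m → Fin n) → Inj f →
  Σ (Fin m → Fin m) λ ρ → Signed ρ × StrictlyIncreasing (f ∘ ρ)
sort-increasing {m} f inj with sort m lt (irr , anti) tr
  where
  lt : Arcs m
  lt i j = does (f i Fin.<? f j)
  irr : ∀ v → lt v v ≡ false
  irr v = dec-false (f v Fin.<? f v) (ℕP.<-irrefl refl)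
  anti : ∀ u v → u ≢ v → lt u v ≡ not (lt v u)
  anti u v u≢v with FinP.<-cmp (f u) (f v)
  ... | tri< a _ c = trans (dec-true (f u Fin.<? f v) a) (cong not (sym (dec-false (f v Fin.<? f u) c)))
  ... | tri≈ _ b _ = contradiction (inj b) u≢v
  ... | tri> a _ c = trans (dec-false (f u Fin.<? f v) a) (cong not (sym (dec-true (f v Fin.<? f u) c)))
  tr : TransitiveOn (λ _ → true) lt
  tr i j k _ _ _ ij jk = dec-true (f i Fin.<? f k)
    (ℕP.<-trans (does-sound (f i Fin.<? f j) ij) (does-sound (f j Fin.<? f k) jk))
... | ρ , s , _ , incr = ρ , s , λ i j i<j → does-sound (f (ρ i) Fin.<? f (ρ j)) (incr i j i<j)

-- Bounds on all subdeterminants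

increasing⇒injective : ∀ {m n} {f : Fin m → Fin n} → StrictlyIncreasing f → Inj f
increasing⇒injective {f = f} incr {x} {y} eq with FinP.<-cmp x y
... | tri< a _ _ = contradiction (incr x y a) (ℕP.<-irrefl (cong toℕ eq))
... | tri≈ _ b _ = b
... | tri> _ _ c = contradiction (incr y x c) (ℕP.<-irrefl (cong toℕ (sym eq)))

-- The condition of `InD` over vertex lists in arbitrary order, so that a subset can be presented in
-- the order that suits an argument. Here `K` is the bound itself, not its square root.
record Bounded (K : ℕ) {n} (T : Arcs n) : Set where
  constructor bounded
  field at-most : ∀ m (f : Fin (suc m) → Fin n) → Inj f → subDet T f ℤ.≤ + K

InD⇒Bounded : ∀ k {n} {T : Arcs n} → InD k T → Bounded (k ℕ.* k) T
InD⇒Bounded k {n} {T} inD = bounded λ m f inj → from-sorted m f (sort-increasing f inj)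
  where
  from-sorted : ∀ m (f : Fin (suc m) → Fin n) →
    (Σ (Fin (suc m) → Fin (suc m)) λ ρ → Signed ρ × StrictlyIncreasing (f ∘ ρ)) →
    subDet T f ℤ.≤ + (k ℕ.* k)
  from-sorted m f (ρ , s , incr) = subst (ℤ._≤ + (k ℕ.* k))
    (det-reindex {ρ = ρ} s (λ i j → skew T (f i) (f j))) (inD m (f ∘ ρ) incr)

Bounded⇒InD : ∀ k {n} {T : Arcs n} → Bounded (k ℕ.* k) T → InD k T
Bounded⇒InD k (bounded bd) m f incr = bd m f (increasing⇒injective incr)

bounded-switch : ∀ {K n} {T : Arcs n} (W : Fin n → Bool) → IsTournament T →
  Bounded K T → Bounded K (switch T W)
bounded-switch {K} W t (bounded bd) = bounded λ m f inj →
  subst (ℤ._≤ + K) (sym (subDet-switch W t f)) (bd m f inj)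

bounded-on : ∀ {K k n} {T : Arcs n} {e : Fin k → Fin n} → Inj e → Bounded K T → Bounded K (T on e)
bounded-on {e = e} inj (bounded bd) = bounded λ m f inj′ → bd m (e ∘ f) (inj′ ∘ inj)

bounded-cong : ∀ {K n} {S T : Arcs n} → (∀ u v → S u v ≡ T u v) → Bounded K S → Bounded K T
bounded-cong {K} {S = S} {T} eq (bounded bd) = bounded λ m f inj → subst (ℤ._≤ + K)
  (det-cong (suc m) {λ i j → skew S (f i) (f j)} {λ i j → skew T (f i) (f j)}
    (λ i j → skew-cong {S = S} {T} (eq (f i) (f j)) (eq (f j) (f i))))
  (bd m f inj)

-- Removing twins

-- The map `b` names the block of each vertex. `Across` and `Within` together describe a transitive
-- blowup without choosing an isomorphism; blocks may be empty.
Across : ∀ {r n} → Arcs r → Arcs n → (Fin n → Fin r) → Set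
Across R S b = ∀ u v → b u ≢ b v → S u v ≡ R (b u) (b v)

Within : ∀ {r n} → Arcs n → (Fin n → Fin r) → Set
Within S b = ∀ u v w → b u ≡ b v → b v ≡ b w → S u v ≡ true → S v w ≡ true → S u w ≡ true

lift-injective : ∀ {n} {ρ : Fin n → Fin n} → Inj ρ → Inj (lift ρ)
lift-injective inj {zero}  {zero}  _  = refl
lift-injective inj {suc i} {suc j} eq = cong suc (inj (FinP.suc-injective eq))

toFront-injective : ∀ {n} (k : Fin (suc n)) → Inj (toFront k)
toFront-injective k {zero}  {zero}  _  = refl
toFront-injective k {zero}  {suc j} eq = contradiction (sym eq) (FinP.punchInᵢ≢i k j)
toFront-injective k {suc i} {zero}  eq = contradiction eq (FinP.punchInᵢ≢i k i)
toFront-injective k {suc i} {suc j} eq = cong suc (FinP.punchIn-injective k i j eq)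

twins-to-front : ∀ {n} (x y : Fin (suc (suc n))) → x ≢ y →
  Σ (Fin (suc (suc n)) → Fin (suc (suc n))) λ ρ →
  Signed ρ × Inj ρ × ρ zero ≡ x × ρ (suc zero) ≡ y
twins-to-front x y x≢y = toFront x ∘ lift (toFront k) ,
  signed-∘ {ρ = toFront x} {σ = lift (toFront k)} (signed-toFront x)
    (signed-lift {ρ = toFront k} (signed-toFront k)) ,
  (λ eq → lift-injective (toFront-injective k) (toFront-injective x eq)) ,
  refl , toFront-punchOut x≢y
  where k = punchOut x≢y

-- A record, so that type checking never unfolds determinants of size suc n.
infix 4 _≅_
record _≅_ {m n} (M : Matrix m) (N : Matrix n) : Set where
  constructor ≅-intro
  field det-≡ : det m M ≡ det n N

open _≅_

≅-sym : ∀ {m n} {M : Matrix m} {N : Matrix n} → M ≅ N → N ≅ M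
≅-sym e = ≅-intro (sym (det-≡ e))

≅-trans : ∀ {l m n} {L : Matrix l} {M : Matrix m} {N : Matrix n} → L ≅ M → M ≅ N → L ≅ N
≅-trans e f = ≅-intro (trans (det-≡ e) (det-≡ f))

reindex-≅ : ∀ {n} {ρ : Fin n → Fin n} → Signed ρ → (M : Matrix n) → (λ i j → M (ρ i) (ρ j)) ≅ M
reindex-≅ {ρ = ρ} s M = ≅-intro (det-reindex {ρ = ρ} s M)

twins-≅ : ∀ {n} (M : Matrix (suc (suc n))) →
  M zero zero ≡ + 0 → M (suc zero) (suc zero) ≡ + 0 →
  M zero (suc zero) ≡ + 1 → M (suc zero) zero ≡ - (+ 1) →
  (∀ j → M zero (suc (suc j)) ≡ M (suc zero) (suc (suc j))) →
  (∀ j → M (suc (suc j)) zero ≡ M (suc (suc j)) (suc zero)) →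
  M ≅ (λ a b → M (suc (suc a)) (suc (suc b)))
twins-≅ {n} M p q r s t u = ≅-intro (det-twins n M p q r s t u)

skew-diagonal : ∀ {n} {S : Arcs n} → IsTournament S → ∀ u → skew S u u ≡ + 0
skew-diagonal (irr , _) u rewrite irr u = refl

skew-forward : ∀ {n} {S : Arcs n} {u v} → S u v ≡ true → skew S u v ≡ + 1
skew-forward uv rewrite uv = refl

skew-backward : ∀ {n} {S : Arcs n} {u v} → IsTournament S → S u v ≡ true → skew S v u ≡ - (+ 1)
skew-backward tS uv rewrite asym tS uv | uv = refl

-- The permutation `ρ` puts the twins first, as `det-twins` expects; in a tournament their in-arcs
-- agree because their out-arcs do.
delete-twins : ∀ {n} (S : Arcs (suc (suc n))) → IsTournament S →
  (ρ : Fin (suc (suc n)) → Fin (suc (suc n))) → Signed ρ → Inj ρ →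
  S (ρ zero) (ρ (suc zero)) ≡ true →
  (∀ k → S (ρ zero) (ρ (suc (suc k))) ≡ S (ρ (suc zero)) (ρ (suc (suc k)))) →
  skew S ≅ skew (S on λ i → ρ (suc (suc i)))
delete-twins S tS ρ sρ inj x→y out =
  ≅-trans (≅-sym (reindex-≅ {ρ = ρ} sρ (skew S)))
    (twins-≅ (λ u v → skew S (ρ u) (ρ v))
      (skew-diagonal tS (ρ zero)) (skew-diagonal tS (ρ (suc zero)))
      (skew-forward {S = S} x→y) (skew-backward tS x→y)
      (λ k → skew-cong {S = S} {S} (out k) (into k))
      (λ k → skew-cong {S = S} {S} (into k) (out k)))
  where
  reverse : ∀ k u → suc (suc k) ≢ u → S (ρ (suc (suc k))) (ρ u) ≡ not (S (ρ u) (ρ (suc (suc k))))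
  reverse k u ne = proj₂ tS _ _ (ne ∘ inj)
  into : ∀ k → S (ρ (suc (suc k))) (ρ zero) ≡ S (ρ (suc (suc k))) (ρ (suc zero))
  into k = trans (reverse k zero (λ ())) (trans (cong not (out k)) (sym (reverse k (suc zero) (λ ()))))

-- The first two vertices of a block with at least two vertices are twins.
find-twins : ∀ {r n} (R : Arcs r) (S : Arcs n) → IsTournament S → (b : Fin n → Fin r) →
  Across R S b → Within S b → ∀ i j → i ≢ j → b i ≡ b j →
  ∃ λ x → ∃ λ y → S x y ≡ true × x ≢ y × (∀ z → z ≢ x → z ≢ y → S x z ≡ S y z)
find-twins {n = n} R S tS b across within i j i≢j bi≡bj with source n S P tS P-trans
  where
  P : Fin n → Bool
  P v = does (b v Fin.≟ b i)
  P-trans : TransitiveOn P S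
  P-trans u v w pu pv pw = within u v w (trans (is u pu) (sym (is v pv))) (trans (is v pv) (sym (is w pw)))
    where
    is : ∀ u → P u ≡ true → b u ≡ b i
    is u = does-sound (b u Fin.≟ b i)
... | inj₁ none = ⊥-elim (false≢true (none i) (dec-true (b i Fin.≟ b i) refl))
... | inj₂ (x , px , x-first) with source n S P tS P-trans
  where
  P : Fin n → Bool
  P v = does (b v Fin.≟ b i ×-dec ¬? (v Fin.≟ x))
  P-trans : TransitiveOn P S
  P-trans u v w pu pv pw = within u v w (trans (is u pu) (sym (is v pv))) (trans (is v pv) (sym (is w pw)))
    where
    is : ∀ u → P u ≡ true → b u ≡ b i
    is u p = proj₁ (does-sound (b u Fin.≟ b i ×-dec ¬? (u Fin.≟ x)) p)
...   | inj₁ none = ⊥-elim (other (i Fin.≟ x))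
  where
  absent : ∀ v → b v ≡ b i → v ≢ x → ⊥
  absent v bv v≢x = false≢true (none v) (dec-true (b v Fin.≟ b i ×-dec ¬? (v Fin.≟ x)) (bv , v≢x))
  other : Dec (i ≡ x) → ⊥
  other (no i≢x)   = absent i refl i≢x
  other (yes refl) = absent j (sym bi≡bj) (i≢j ∘ sym)
...   | inj₂ (y , py , y-first) = x , y , x-first y (dec-true (b y Fin.≟ b i) b-y) y≢x , y≢x ∘ sym , twin
  where
  b-x : b x ≡ b i
  b-x = does-sound (b x Fin.≟ b i) px
  b-y : b y ≡ b i
  b-y = proj₁ (does-sound (b y Fin.≟ b i ×-dec ¬? (y Fin.≟ x)) py)
  y≢x : y ≢ x
  y≢x = proj₂ (does-sound (b y Fin.≟ b i ×-dec ¬? (y Fin.≟ x)) py)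
  twin : ∀ z → z ≢ x → z ≢ y → S x z ≡ S y z
  twin z z≢x z≢y with b z Fin.≟ b i
  ... | yes bz = trans (x-first z (dec-true (b z Fin.≟ b i) bz) z≢x)
    (sym (y-first z (dec-true (b z Fin.≟ b i ×-dec ¬? (z Fin.≟ x)) (bz , z≢x)) z≢y))
  ... | no ¬bz = trans (across x z (λ e → ¬bz (trans (sym e) b-x))) (trans
    (cong (λ c → R c (b z)) (trans b-x (sym b-y)))
    (sym (across y z (λ e → ¬bz (trans (sym e) b-y)))))

Collapse : ∀ {r n} → Arcs r → Arcs n → Set
Collapse {r} R S = Σ ℕ λ m → Σ (Fin m → Fin r) λ h → Inj h × skew S ≅ skew (R on h)

-- Deleting a pair of twins keeps the block structure and lowers the size by two. Once no block has
-- two vertices, `b` embeds what is left in `R`. The bound `N` makes the recursion structural.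
det-collapse : ∀ {r} (R : Arcs r) → IsTournament R → ∀ N n → n ℕ.≤ N →
  (S : Arcs n) → IsTournament S → (b : Fin n → Fin r) → Across R S b → Within S b → Collapse R S
det-collapse {r} R tR N n n≤N S tS b across within
  with FinP.any? (λ i → FinP.any? (λ j → ¬? (i Fin.≟ j) ×-dec (b i Fin.≟ b j)))
... | no ¬pair = n , b , inj , ≅-intro (det-cong n {skew S} {λ i j → skew R (b i) (b j)} agree)
  where
  inj : Inj b
  inj {i} {j} eq with i Fin.≟ j
  ... | yes i≡j = i≡j
  ... | no i≢j  = contradiction (i , j , i≢j , eq) ¬pair
  entry : ∀ i j → S i j ≡ R (b i) (b j)
  entry i j with i Fin.≟ j
  ... | yes refl = trans (proj₁ tS i) (sym (proj₁ tR (b i)))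
  ... | no i≢j   = across i j (i≢j ∘ inj)
  agree : ∀ i j → skew S i j ≡ skew R (b i) (b j)
  agree i j = skew-cong {S = S} {R} (entry i j) (entry j i)
det-collapse R tR (suc N) (suc zero) n≤N S tS b across within
    | yes (zero , zero , i≢j , _) = contradiction refl i≢j
det-collapse R tR (suc N) (suc (suc n)) (s≤s n≤N) S tS b across within
    | yes (i , j , i≢j , bi≡bj)
  with x , y , x→y , x≢y , twin ← find-twins R S tS b across within i j i≢j bi≡bj
  with ρ , sρ , inj , refl , refl ← twins-to-front x y x≢y
  with m , h , inj-h , same′ ← det-collapse R tR N n (ℕP.≤-trans (ℕP.n≤1+n n) n≤N)
         (S on λ i → ρ (suc (suc i))) (tournament-on (FinP.suc-injective ∘ FinP.suc-injective ∘ inj) tS)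
         (λ i → b (ρ (suc (suc i))))
         (λ u v → across (ρ (suc (suc u))) (ρ (suc (suc v))))
         (λ u v w → within (ρ (suc (suc u))) (ρ (suc (suc v))) (ρ (suc (suc w))))
  = m , h , inj-h , ≅-trans
      (delete-twins S tS ρ sρ inj x→y (λ k → twin (ρ (suc (suc k)))
        (λ e → contradiction (inj e) (λ ())) (λ e → contradiction (inj e) (λ ()))))
      same′

record Blocks {r n} (R : Arcs r) (T : Arcs n) : Set where
  field
    W      : Fin n → Bool
    b      : Fin n → Fin r
    across : Across R (switch T W) b
    within : Within (switch T W) b

-- Every subdeterminant of `T` collapses to one of `R`. The sizes in `small` start at 0, because
-- removing twins can exhaust a subtournament.
blocks-bounded : ∀ {K r n} {R : Arcs r} {T : Arcs n} → IsTournament R → IsTournament T →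
  (∀ m (h : Fin m → Fin r) → Inj h → subDet R h ℤ.≤ + K) → Blocks R T → Bounded K T
blocks-bounded {K} {n = n} {R = R} {T} tR tT small B = bounded λ m f inj → transport (suc m) f
  (det-collapse R tR (suc m) (suc m) ℕP.≤-refl
    (switch T (Blocks.W B) on f) (tournament-on inj (switch-tournament (Blocks.W B) tT))
    (Blocks.b B ∘ f)
    (λ u v → Blocks.across B (f u) (f v)) (λ u v w → Blocks.within B (f u) (f v) (f w)))
  where
  transport : ∀ m (f : Fin m → Fin n) → Collapse R (switch T (Blocks.W B) on f) → subDet T f ℤ.≤ + K
  transport m f (m′ , h , inj-h , eq) = subst (ℤ._≤ + K)
    (trans (sym (det-≡ eq)) (subDet-switch (Blocks.W B) tT f)) (small m′ h inj-h)

-- Blowups as block decompositions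

blowup-across : ∀ {r} (R : Arcs r) a (p q : BlowupV a) → proj₁ p ≢ proj₁ q →
  blowup R a p q ≡ R (proj₁ p) (proj₁ q)
blowup-across R a (i , _) (j , _) i≢j rewrite dec-false (i Fin.≟ j) i≢j = refl

blowup-within : ∀ {r} (R : Arcs r) a (p q : BlowupV a) → proj₁ p ≡ proj₁ q →
  blowup R a p q ≡ (toℕ (proj₂ p) ℕ.<ᵇ toℕ (proj₂ q))
blowup-within R a (i , _) (j , _) i≡j rewrite dec-true (i Fin.≟ j) i≡j = refl

<ᵇ-trans : ∀ x y z → (x ℕ.<ᵇ y) ≡ true → (y ℕ.<ᵇ z) ≡ true → (x ℕ.<ᵇ z) ≡ true
<ᵇ-trans x y z xy yz = dec-true (x ℕ.<? z)
  (ℕP.<-trans (does-sound (x ℕ.<? y) xy) (does-sound (y ℕ.<? z) yz))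

blowup⇒blocks : ∀ {r n} {R : Arcs r} {T : Arcs n} (W : Fin n → Bool) a →
  Isomorphic (switch T W) (blowup R a) → Blocks R T
blowup⇒blocks {R = R} {T} W a (φ , eq) = record
  { W = W
  ; b = proj₁ ∘ to
  ; across = λ u v ne → trans (eq u v) (blowup-across R a (to u) (to v) ne)
  ; within = λ u v w uv vw p q → trans (inside u w (trans uv vw))
      (<ᵇ-trans (pos u) (pos v) (pos w)
        (trans (sym (inside u v uv)) p) (trans (sym (inside v w vw)) q))
  }
  where
  open Inverse φ using (to)
  pos : ∀ u → ℕ
  pos u = toℕ (proj₂ (to u))
  inside : ∀ u v → proj₁ (to u) ≡ proj₁ (to v) → switch T W u v ≡ (pos u ℕ.<ᵇ pos v)
  inside u v e = trans (eq u v) (blowup-within R a (to u) (to v) e)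

cons : ∀ {A : Set} {k} → A → (Fin k → A) → Fin (suc k) → A
cons x f zero    = x
cons x f (suc i) = f i

cons-injective : ∀ {A : Set} {k} {x : A} {f : Fin k → A} → Inj f → (∀ i → f i ≢ x) → Inj (cons x f)
cons-injective inj ne {zero}  {zero}  _  = refl
cons-injective inj ne {zero}  {suc j} eq = contradiction (sym eq) (ne j)
cons-injective inj ne {suc i} {zero}  eq = contradiction eq (ne i)
cons-injective inj ne {suc i} {suc j} eq = cong suc (inj eq)

enumerate : ∀ n (P : Fin n → Bool) → Σ ℕ λ a → Σ (Fin a → Fin n) λ e →
  Inj e × (∀ k → P (e k) ≡ true) × (∀ v → P v ≡ true → ∃ λ k → e k ≡ v)
enumerate zero    P = zero , (λ ()) , (λ {x} → λ { {()} }) , (λ ()) , λ ()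
enumerate (suc n) P with P zero in p₀ | enumerate n (P ∘ suc)
... | false | a , e , inj , sound , complete = a , suc ∘ e , inj ∘ FinP.suc-injective , sound , complete′
  where
  complete′ : ∀ v → P v ≡ true → ∃ λ k → suc (e k) ≡ v
  complete′ zero    pv = ⊥-elim (false≢true p₀ pv)
  complete′ (suc v) pv with k , eq ← complete v pv = k , cong suc eq
... | true | a , e , inj , sound , complete =
  suc a , cons zero (suc ∘ e) , cons-injective (inj ∘ FinP.suc-injective) (λ _ ()) , sound′ , complete′
  where
  sound′ : ∀ k → P (cons zero (suc ∘ e) k) ≡ true
  sound′ zero    = p₀
  sound′ (suc k) = sound k
  complete′ : ∀ v → P v ≡ true → ∃ λ k → cons zero (suc ∘ e) k ≡ v
  complete′ zero    pv = zero , refl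
  complete′ (suc v) pv with k , eq ← complete v pv = suc k , cong suc eq

record Listing {n} (S : Arcs n) (P : Fin n → Bool) : Set where
  field
    size       : ℕ
    at         : Fin size → Fin n
    sound      : ∀ k → P (at k) ≡ true
    complete   : ∀ v → P v ≡ true → ∃ λ k → at k ≡ v
    increasing : ∀ i j → i Fin.< j → S (at i) (at j) ≡ true

listing : ∀ {n} (S : Arcs n) → IsTournament S → (P : Fin n → Bool) → TransitiveOn P S → Listing S P
listing {n} S tS P tr with enumerate n P
... | a , e , inj , sound , complete with sort a (S on e) (tournament-on inj tS)
      (λ i j k _ _ _ → tr (e i) (e j) (e k) (sound i) (sound j) (sound k))
...   | ρ , _ , onto , incr = record
  { size = a ; at = e ∘ ρ ; sound = sound ∘ ρ ; complete = complete′ ; increasing = incr }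
  where
  complete′ : ∀ v → P v ≡ true → ∃ λ k → e (ρ k) ≡ v
  complete′ v pv with complete v pv
  ... | k , refl with onto k
  ...   | l , eq = l , cong e eq

-- Each block is listed in its transitive order, and a vertex is sent to its block together with its
-- position there. Only blocks that `b` attains are claimed to be nonempty.
blocks⇒blowup : ∀ {r n} {R : Arcs r} {T : Arcs n} → IsTournament T → (B : Blocks R T) →
  Σ (Fin r → ℕ) λ a → (∀ v → 1 ℕ.≤ a (Blocks.b B v)) ×
  Isomorphic (switch T (Blocks.W B)) (blowup R a)
blocks⇒blowup {r} {n} {R} {T} tT B = a , nonempty , mk↔ₛ′ to from to∘from from∘to , agree
  where
  open Blocks B
  S : Arcs n
  S = switch T W
  tS : IsTournament S
  tS = switch-tournament W tT
  P : Fin r → Fin n → Bool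
  P i v = does (b v Fin.≟ i)
  P-trans : ∀ i → TransitiveOn (P i) S
  P-trans i u v w pu pv pw = within u v w (trans (is u pu) (sym (is v pv))) (trans (is v pv) (sym (is w pw)))
    where
    is : ∀ u → P i u ≡ true → b u ≡ i
    is u = does-sound (b u Fin.≟ i)
  block : ∀ i → Listing S (P i)
  block i = listing S tS (P i) (P-trans i)
  a : Fin r → ℕ
  a i = Listing.size (block i)
  e : ∀ i → Fin (a i) → Fin n
  e i = Listing.at (block i)
  in-block : ∀ i k → b (e i k) ≡ i
  in-block i k = does-sound (b (e i k) Fin.≟ i) (Listing.sound (block i) k)
  index : ∀ v → ∃ λ k → e (b v) k ≡ v
  index v = Listing.complete (block (b v)) v (dec-true (b v Fin.≟ b v) refl)
  inhabited : ∀ {m} → Fin m → 1 ℕ.≤ m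
  inhabited {suc m} _ = s≤s z≤n
  nonempty : ∀ v → 1 ℕ.≤ a (b v)
  nonempty v = inhabited (proj₁ (index v))
  -- Here `i` and `j` are separate variables so that `i ≡ j` can be matched with `refl`.
  order : ∀ i j (k : Fin (a i)) (l : Fin (a j)) → i ≡ j → S (e i k) (e j l) ≡ (toℕ k ℕ.<ᵇ toℕ l)
  order i .i k l refl with FinP.<-cmp k l
  ... | tri< k<l _ _ = trans (Listing.increasing (block i) k l k<l) (sym (dec-true (toℕ k ℕ.<? toℕ l) k<l))
  ... | tri≈ _ refl _ = trans (proj₁ tS (e i k)) (sym (dec-false (toℕ k ℕ.<? toℕ k) (ℕP.<-irrefl refl)))
  ... | tri> k≮l _ l<k = trans (asym tS (Listing.increasing (block i) l k l<k))
    (sym (dec-false (toℕ k ℕ.<? toℕ l) k≮l))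
  to : Fin n → BlowupV a
  to v = b v , proj₁ (index v)
  from : BlowupV a → Fin n
  from (i , k) = e i k
  from∘to : ∀ v → from (to v) ≡ v
  from∘to v = proj₂ (index v)
  -- A vertex listed at two positions of one block would carry a loop.
  same : ∀ i j (k : Fin (a i)) (l : Fin (a j)) → i ≡ j → e i k ≡ e j l → _≡_ {A = BlowupV a} (i , k) (j , l)
  same i .i k l refl eq with FinP.<-cmp k l
  ... | tri≈ _ refl _ = refl
  ... | tri< k<l _ _ = ⊥-elim (false≢true (proj₁ tS (e i k))
    (trans (cong (S (e i k)) eq) (Listing.increasing (block i) k l k<l)))
  ... | tri> _ _ l<k = ⊥-elim (false≢true (proj₁ tS (e i l))
    (trans (cong (S (e i l)) (sym eq)) (Listing.increasing (block i) l k l<k)))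
  to∘from : ∀ p → to (from p) ≡ p
  to∘from (i , k) = same (b (e i k)) i (proj₁ (index (e i k))) k (in-block i k) (from∘to (e i k))
  agree : ∀ u v → S u v ≡ blowup R a (to u) (to v)
  agree u v with b u Fin.≟ b v
  ... | no ne = across u v ne
  ... | yes eq = trans (cong₂ S (sym (from∘to u)) (sym (from∘to v)))
    (order (b u) (b v) (proj₁ (index u)) (proj₁ (index v)) eq)

-- Decision procedures for small tournaments

ext : ∀ {k} → Arcs k → (Fin k → Bool) → Arcs (suc k)
ext S t zero    zero    = false
ext S t zero    (suc j) = t j
ext S t (suc i) zero    = not (t i)
ext S t (suc i) (suc j) = S i j

lookup-removeAt : ∀ {A : Set} {n} (xs : Vec A (suc n)) j b →
  lookup (removeAt xs j) b ≡ lookup xs (punchIn j b)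
lookup-removeAt (x ∷ xs)         zero    b       = refl
lookup-removeAt (x ∷ xs@(_ ∷ _)) (suc j) zero    = refl
lookup-removeAt (x ∷ xs@(_ ∷ _)) (suc j) (suc b) = lookup-removeAt xs j b

-- Determinant of a matrix stored as rows, which evaluates fast enough for the
-- exhaustive checks below.
detV : ∀ n → Vec (Vec ℤ n) n → ℤ
detV zero    _        = + 1
detV (suc n) (r ∷ rs) = sumFin (suc n) λ j →
  sign (toℕ j) * lookup r j * detV n (Vec.map (λ row → removeAt row j) rs)

det≡detV : ∀ n (V : Vec (Vec ℤ n) n) → det n (λ i j → lookup (lookup V i) j) ≡ detV n V
det≡detV zero    V        = refl
det≡detV (suc n) (r ∷ rs) = sum-cong (suc n) λ j → cong (sign (toℕ j) * lookup r j *_) (trans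
  (det-cong n λ a b → sym (trans
    (cong (λ row → lookup row b) (VecP.lookup-map a (λ row → removeAt row j) rs))
    (lookup-removeAt (lookup rs a) j b)))
  (det≡detV n (Vec.map (λ row → removeAt row j) rs)))

rows : ∀ {n} → Matrix n → Vec (Vec ℤ n) n
rows M = tabulate (λ i → tabulate (M i))

det≡detV-rows : ∀ n (M : Matrix n) → det n M ≡ detV n (rows M)
det≡detV-rows n M = trans
  (det-cong n {M} {λ i j → lookup (lookup (rows M) i) j} λ i j → sym (trans
    (cong (λ row → lookup row j) (VecP.lookup∘tabulate (λ i → tabulate (M i)) i))
    (VecP.lookup∘tabulate (M i) j)))
  (det≡detV n (rows M))

Candidate : ℕ → Set
Candidate k = ∃ λ m → Vec (Fin k) (suc m)

Distinct : ∀ {k m} → Vec (Fin k) m → Set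
Distinct v = ∀ i j → lookup v i ≡ lookup v j → i ≡ j

-- A certificate that a determinant is too large, phrased with `detV` so that deciding it is a
-- feasible computation.
record Exceeds (K : ℕ) {k} (S : Arcs k) (c : Candidate k) : Set where
  constructor exceeding
  field
    distinct : Distinct (proj₂ c)
    larger   : + K ℤ.< detV (suc (proj₁ c)) (rows (skew (S on lookup (proj₂ c))))

exceeds? : ∀ K {k} (S : Arcs k) → Decidable (Exceeds K S)
exceeds? K S (m , v) = map′ (λ (d , l) → exceeding d l) (λ (exceeding d l) → d , l)
  ((FinP.all? λ i → FinP.all? λ j → (lookup v i Fin.≟ lookup v j) →-dec (i Fin.≟ j))
   ×-dec (+ K ℤP.<? detV (suc m) (rows (skew (S on lookup v)))))

exceeds⇒¬bounded : ∀ {K k} {S : Arcs k} {c} → Exceeds K S c → Bounded K S → ⊥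
exceeds⇒¬bounded {K} {S = S} {m , v} (exceeding distinct K<) (bounded bd) = ℤP.<⇒≱ K<
  (subst (ℤ._≤ + K) (det≡detV-rows (suc m) (skew (S on lookup v)))
    (bd m (lookup v) (distinct _ _)))

whole : ∀ {k} → Candidate (suc k)
whole = _ , tabulate (λ i → i)

increasingVecs : ∀ m r → List (Vec (Fin r) m)
increasingVecs zero    r       = [] ∷ []
increasingVecs (suc m) zero    = []
increasingVecs (suc m) (suc r) =
  List.map (λ v → zero ∷ Vec.map suc v) (increasingVecs m r) List.++
  List.map (Vec.map suc) (increasingVecs (suc m) r)

unsuc : ∀ {m r} (f : Fin m → Fin (suc r)) → StrictlyIncreasing f → (∀ i → f i ≢ zero) →
  Σ (Fin m → Fin r) λ g → StrictlyIncreasing g × (∀ i → suc (g i) ≡ f i)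
unsuc f incr ne = g , g-incr , suc-g
  where
  g = λ i → punchOut (ne i ∘ sym)
  suc-g : ∀ i → suc (g i) ≡ f i
  suc-g i = FinP.punchIn-punchOut (ne i ∘ sym)
  g-incr : StrictlyIncreasing g
  g-incr i j i<j = ℕP.≤-pred (subst₂ Fin._<_ (sym (suc-g i)) (sym (suc-g j)) (incr i j i<j))

-- Zero can occur only as the first value, so all remaining values have predecessors, and these
-- again increase.
increasingVecs-complete : ∀ m r (h : Fin m → Fin r) → StrictlyIncreasing h →
  ∃ λ v → v ∈ increasingVecs m r × (∀ i → lookup v i ≡ h i)
increasingVecs-complete zero    r       h incr = [] , here refl , λ ()
increasingVecs-complete (suc m) zero    h incr = contradiction (h zero) FinP.¬Fin0
increasingVecs-complete (suc m) (suc r) h incr with h zero Fin.≟ zero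
... | yes h₀ = let
    after = λ i e → ℕP.n≮0 (subst (λ x → toℕ (h zero) ℕ.< toℕ x) e (incr zero (suc i) (s≤s z≤n)))
    g , g-incr , suc-g = unsuc (h ∘ suc) (λ i j i<j → incr (suc i) (suc j) (s≤s i<j)) after
    v , v∈ , v≗g = increasingVecs-complete m r g g-incr
  in zero ∷ Vec.map suc v ,
     ∈-++⁺ˡ (∈-map⁺ (λ v → zero ∷ Vec.map suc v) v∈) ,
     λ { zero → sym h₀
       ; (suc i) → trans (VecP.lookup-map i suc v) (trans (cong suc (v≗g i)) (suc-g i)) }
... | no h₀≢0 = let
    nonzero = λ { zero → h₀≢0
                ; (suc i) e → ℕP.n≮0 (subst (λ x → toℕ (h zero) ℕ.< toℕ x) e (incr zero (suc i) (s≤s z≤n))) }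
    g , g-incr , suc-g = unsuc h incr nonzero
    v , v∈ , v≗g = increasingVecs-complete (suc m) r g g-incr
  in Vec.map suc v ,
     ∈-++⁺ʳ (List.map (λ v → zero ∷ Vec.map suc v) (increasingVecs m r)) (∈-map⁺ (Vec.map suc) v∈) ,
     λ i → trans (VecP.lookup-map i suc v) (trans (cong suc (v≗g i)) (suc-g i))

-- One increasing vector stands for each vertex subset, from the empty one to all of `R`; sorting
-- reduces every injection to such a vector.
IncreasingBounded : ∀ {r} → ℕ → Arcs r → Set
IncreasingBounded {r} K R = ∀ (m : Fin (suc r)) →
  All (λ v → detV (toℕ m) (rows (skew (R on lookup v))) ℤ.≤ + K) (increasingVecs (toℕ m) r)

increasingBounded? : ∀ {r} K (R : Arcs r) → Dec (IncreasingBounded K R)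
increasingBounded? {r} K R = FinP.all? λ m →
  All.all? (λ v → detV (toℕ m) (rows (skew (R on lookup v))) ℤP.≤? + K) (increasingVecs (toℕ m) r)

increasingBounded⇒ : ∀ {r K} (R : Arcs r) → IncreasingBounded K R →
  ∀ m (h : Fin m → Fin r) → Inj h → subDet R h ℤ.≤ + K
increasingBounded⇒ {r} {K} R small m h inj with sort-increasing h inj
... | ρ , s , incr with increasingVecs-complete m r (h ∘ ρ) incr
...   | v , v∈ , v≗h = subst (ℤ._≤ + K) eq (All.lookup small-m v∈)
  where
  -- Injectivity of `h` gives `m ≤ r`, so `m` is among the sizes checked.
  small-m : All (λ v → detV m (rows (skew (R on lookup v))) ℤ.≤ + K) (increasingVecs m r)
  small-m = subst (λ m → All (λ v → detV m (rows (skew (R on lookup v))) ℤ.≤ + K) (increasingVecs m r))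
    (FinP.toℕ-fromℕ< (s≤s (FinP.injective⇒≤ inj))) (small (Fin.fromℕ< (s≤s (FinP.injective⇒≤ inj))))
  eq : detV m (rows (skew (R on lookup v))) ≡ subDet R h
  eq = trans (sym (det≡detV-rows m (skew (R on lookup v)))) (trans
    (det-cong m {skew (R on lookup v)} {λ i j → skew R (h (ρ i)) (h (ρ j))}
      (λ i j → cong₂ (skew R) (v≗h i) (v≗h j)))
    (det-reindex {ρ = ρ} s (λ i j → skew R (h i) (h j))))

-- Switched copies of a tournament

Occurs : ∀ {r n} → Arcs r → Arcs n → Set
Occurs {r} {n} R T = Σ (Fin r → Fin n) λ x → Σ (Fin r → Bool) λ W →
  ∀ i j → switch (T on x) W i j ≡ R i j

∃Bool? : ∀ {P : Bool → Set} → Decidable P → Dec (∃ P)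
∃Bool? P? = map′ (λ { (inj₁ p) → true , p ; (inj₂ p) → false , p })
  (λ { (true , p) → inj₁ p ; (false , p) → inj₂ p }) (P? true ⊎-dec P? false)

∀Bool? : ∀ {P : Bool → Set} → Decidable P → Dec (∀ b → P b)
∀Bool? P? = map′ (λ { (p , _) true → p ; (_ , p) false → p }) (λ f → f true , f false)
  (P? true ×-dec P? false)

∃Vec? : ∀ {A : Set} → (∀ {P : A → Set} → Decidable P → Dec (∃ P)) →
  ∀ k {P : Vec A k → Set} → Decidable P → Dec (∃ P)
∃Vec? search zero    P? = map′ ([] ,_) (λ { ([] , p) → p }) (P? [])
∃Vec? search (suc k) P? = map′ (λ (x , v , p) → x ∷ v , p) (λ { (x ∷ v , p) → x , v , p })
  (search λ x → ∃Vec? search k λ v → P? (x ∷ v))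

∀BoolVec? : ∀ k {P : Vec Bool k → Set} → Decidable P → Dec (∀ v → P v)
∀BoolVec? zero    P? = map′ (λ { p [] → p }) (λ f → f []) (P? [])
∀BoolVec? (suc k) P? = map′ (λ { f (b ∷ v) → f b v }) (λ f b v → f (b ∷ v))
  (∀Bool? λ b → ∀BoolVec? k λ v → P? (b ∷ v))

_≟ᴬ_ : ∀ {k} (S T : Arcs k) → Dec (∀ i j → S i j ≡ T i j)
S ≟ᴬ T = FinP.all? λ i → FinP.all? λ j → S i j 𝔹P.≟ T i j

-- This decides the case distinctions on containing `L₆` or `L₄`. Maps between finite sets are
-- searched through their tables of values.
occurs? : ∀ {r n} (R : Arcs r) (T : Arcs n) → Dec (Occurs R T)
occurs? {r} R T = map′
  (λ (x , W , eq) → lookup x , lookup W , eq)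
  (λ (x , W , eq) → tabulate x , tabulate W , λ i j → trans (untabulate x W i j) (eq i j))
  (∃Vec? FinP.any? r λ x → ∃Vec? ∃Bool? r λ W → switch (T on lookup x) (lookup W) ≟ᴬ R)
  where
  untabulate : ∀ x W i j → switch (T on lookup (tabulate x)) (lookup (tabulate W)) i j ≡ switch (T on x) W i j
  untabulate x W i j rewrite VecP.lookup∘tabulate x i | VecP.lookup∘tabulate x j
    | VecP.lookup∘tabulate W i | VecP.lookup∘tabulate W j = refl

occurs-on : ∀ {r m n} {R : Arcs r} {T : Arcs n} (f : Fin m → Fin n) → Occurs R (T on f) → Occurs R T
occurs-on f (x , W , eq) = f ∘ x , W , eq

switch-cong : ∀ {V : Set} {S T : V → V → Bool} W → (∀ u v → S u v ≡ T u v) →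
  ∀ u v → switch S W u v ≡ switch T W u v
switch-cong W eq u v with W u xor W v
... | true  = eq v u
... | false = eq u v

occurs-cong : ∀ {r n} {R : Arcs r} {S T : Arcs n} → (∀ u v → S u v ≡ T u v) → Occurs R S → Occurs R T
occurs-cong eq (x , W , occ) = x , W , λ i j →
  trans (switch-cong W (λ u v → sym (eq (x u) (x v))) i j) (occ i j)

occurs-switch : ∀ {r n} {R : Arcs r} {T : Arcs n} (W : Fin n → Bool) → Occurs R (switch T W) → Occurs R T
occurs-switch {T = T} W (x , W′ , occ) = x , (λ i → W (x i) xor W′ i) , λ i j →
  trans (sym (switch-switch (T on x) (W ∘ x) W′ i j)) (occ i j)

-- If two positions shared a vertex, both arcs of `R` between them would come from a loop of `T` and
-- be absent, whereas one of them must be present.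
occurs-injective : ∀ {r n} {R : Arcs r} {T : Arcs n} → IsTournament R → IsTournament T →
  (occ : Occurs R T) → Inj (proj₁ occ)
occurs-injective {R = R} {T} tR tT (x , W , occ) {i} {j} eq with i Fin.≟ j
... | yes i≡j = i≡j
... | no i≢j  = contradiction
  (trans (sym (off i j eq)) (trans (proj₂ tR i j i≢j) (cong not (off j i (sym eq))))) (λ ())
  where
  off : ∀ i j → x i ≡ x j → R i j ≡ false
  off i j e = trans (sym (occ i j)) (loop (W i xor W j))
    where
    loop : ∀ b → (if b then T (x j) (x i) else T (x i) (x j)) ≡ false
    loop true  = trans (cong (λ y → T y (x i)) (sym e)) (proj₁ tT (x i))
    loop false = trans (cong (T (x i)) (sym e)) (proj₁ tT (x i))

-- Exhaustive checks around L₄ and L₆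

L₄ : Arcs 4
L₄ = L 3

isTournament? : ∀ {k} (S : Arcs k) → Dec (IsTournament S)
isTournament? S = (FinP.all? λ v → S v v 𝔹P.≟ false) ×-dec
  (FinP.all? λ u → FinP.all? λ v → ¬? (u Fin.≟ v) →-dec (S u v 𝔹P.≟ not (S v u)))

abstract
  L₆-tournament : IsTournament L₆
  L₆-tournament = from-yes (isTournament? L₆)

  L₄-tournament : IsTournament L₄
  L₄-tournament = from-yes (isTournament? L₄)

  L₆-bounded : IncreasingBounded 25 L₆
  L₆-bounded = from-yes (increasingBounded? 25 L₆)

  L₄-bounded : IncreasingBounded 9 L₄
  L₄-bounded = from-yes (increasingBounded? 9 L₄)

  L₆-exceeds-9 : Exceeds 9 L₆ whole
  L₆-exceeds-9 = from-yes (exceeds? 9 L₆ whole)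

-- Here `t` is the row of a new vertex, which looks like a twin of `i` after being switched or not
-- according to `s`. Its entry at `i` itself is free, as a twin may lie on either side.
TwinType : ∀ {r} → Arcs r → (Fin r → Bool) → Set
TwinType {r} R t = Σ (Fin r) λ i → Σ Bool λ s → ∀ j → j ≢ i → t j xor s ≡ R i j

twinType? : ∀ {r} (R : Arcs r) → Decidable (TwinType R)
twinType? R t = FinP.any? λ i → ∃Bool? λ s → FinP.all? λ j → ¬? (j Fin.≟ i) →-dec (t j xor s 𝔹P.≟ R i j)

abstract
  -- All 64 rows are tried, each against the seven 6-subsets of the extended tournament.
  one-vertex₆ : ∀ (t : Vec Bool 6) → TwinType L₆ (lookup t) ⊎
    Any (λ v → Exceeds 25 (ext L₆ (lookup t)) (5 , v)) (increasingVecs 6 7)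
  one-vertex₆ = from-yes (∀BoolVec? 6 λ t → twinType? L₆ (lookup t) ⊎-dec
    Any.any? (λ v → exceeds? 25 (ext L₆ (lookup t)) (5 , v)) (increasingVecs 6 7))

  -- Four choices of `i`, two of the switching and two of the entry at `i` account for all 16 rows,
  -- so no determinant is involved.
  one-vertex₄ : ∀ (t : Vec Bool 4) → TwinType L₄ (lookup t)
  one-vertex₄ = from-yes (∀BoolVec? 4 λ t → twinType? L₄ (lookup t))

-- A row of R with its diagonal entry, which says on which side of its twin a
-- new vertex lies, set to p.
twinRow : ∀ {r} → Arcs r → Fin r → Bool → Fin r → Bool
twinRow R i p k = if does (k Fin.≟ i) then p else R i k

-- R with twins of i and j added, whose mutual arc is the wrong way round.
wrongPair : ∀ {r} → Arcs r → Fin r → Fin r → Bool → Bool → Arcs (suc (suc r))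
wrongPair R i j p q = ext (ext R (twinRow R j q)) (cons (not (R i j)) (twinRow R i p))

∀Pair? : ∀ {r} {P : Fin r → Fin r → Bool → Bool → Set} → (∀ i j p q → Dec (P i j p q)) →
  Dec (∀ i j p q → P i j p q)
∀Pair? P? = FinP.all? λ i → FinP.all? λ j → ∀Bool? λ p → ∀Bool? λ q → P? i j p q

-- Leaves out `i` and `punchIn i j`. In `wrongPair` over `L₆` vertices 0 and 1 are the new twins;
-- the pairs omitted below are all pairs from vertices 2 to 6, so both twins and the last vertex of
-- `L₆` always stay.
omit : Fin 8 → Fin 7 → Candidate 8
omit i j = 5 , tabulate (λ k → punchIn i (punchIn j k))

-- The whole 8-vertex tournament, of determinant 49, is needed only for some
-- twins of five of the pairs of blocks.
candidates₈ : List (Candidate 8)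
candidates₈ =
  omit (# 4) (# 4) ∷ omit (# 2) (# 5) ∷ omit (# 5) (# 5) ∷ omit (# 2) (# 2) ∷ omit (# 3) (# 3) ∷
  omit (# 2) (# 3) ∷ omit (# 2) (# 4) ∷ omit (# 3) (# 4) ∷ omit (# 3) (# 5) ∷ omit (# 4) (# 5) ∷
  whole ∷ []

abstract
  two-vertices₆ : ∀ i j p q → i ≡ j ⊎ Any (Exceeds 25 (wrongPair L₆ i j p q)) candidates₈
  two-vertices₆ = from-yes (∀Pair? λ i j p q →
    (i Fin.≟ j) ⊎-dec Any.any? (exceeds? 25 (wrongPair L₆ i j p q)) candidates₈)

permutations : ∀ n → List (Vec (Fin n) n)
permutations zero    = [] ∷ []
permutations (suc n) =
  concatMap (λ k → List.map (λ v → k ∷ Vec.map (punchIn k) v) (permutations n)) (allFin (suc n))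

-- The switching that gives the vertex v₀ of S the arcs of vertex 0 of R.
matchingSwitch : ∀ {r k} → Arcs (suc r) → Arcs k → Vec (Fin k) (suc r) → Fin (suc r) → Bool
matchingSwitch R S v i = S (lookup v zero) (lookup v i) xor R zero i

record OccursAt {r k} (R : Arcs (suc r)) (S : Arcs k) (v : Vec (Fin k) (suc r)) : Set where
  constructor occurring
  field copy : ∀ i j → switch (S on lookup v) (matchingSwitch R S v) i j ≡ R i j

occursAt? : ∀ {r k} (R : Arcs (suc r)) (S : Arcs k) → Decidable (OccursAt R S)
occursAt? R S v = map′ occurring OccursAt.copy (switch (S on lookup v) (matchingSwitch R S v) ≟ᴬ R)

abstract
  -- Unlike for `L₆`, a wrong pair over `L₄` need not have a large determinant: its six vertices may
  -- instead form a switched `L₆`. This is why `L₆` is excluded when blocks are built around `L₄`.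
  two-vertices₄ : ∀ i j p q → i ≡ j ⊎ Exceeds 25 (wrongPair L₄ i j p q) whole ⊎
    Any (OccursAt L₆ (wrongPair L₄ i j p q)) (permutations 6)
  two-vertices₄ = from-yes (∀Pair? λ i j p q →
    (i Fin.≟ j) ⊎-dec exceeds? 25 (wrongPair L₄ i j p q) whole ⊎-dec
    Any.any? (occursAt? L₆ (wrongPair L₄ i j p q)) (permutations 6))

-- A cyclic triangle of twins of i, over three further vertices τ of R.
twinTriangle : ∀ {r} → Arcs r → Fin r → (Fin 3 → Fin r) → Arcs 6
twinTriangle R i τ = ext (ext (ext (R on τ) t) (cons true t)) (cons true (cons false t))
  where t = λ k → R i (τ k)

-- For each `i`, three vertices over which a cyclic triangle of twins of `i` is too large, as
-- `triangle₆` checks. For `L₄` the three vertices other than `i` are the only choice.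
others₆ : Fin 6 → Vec (Fin 6) 3
others₆ = lookup (
  (# 3 ∷ # 4 ∷ # 5 ∷ []) ∷ (# 0 ∷ # 4 ∷ # 5 ∷ []) ∷ (# 0 ∷ # 1 ∷ # 5 ∷ []) ∷
  (# 0 ∷ # 4 ∷ # 5 ∷ []) ∷ (# 0 ∷ # 1 ∷ # 5 ∷ []) ∷ (# 0 ∷ # 1 ∷ # 2 ∷ []) ∷ [])

others₄ : Fin 4 → Vec (Fin 4) 3
others₄ i = tabulate (punchIn i)

Avoids : ∀ {r k} → Fin r → Vec (Fin r) k → Set
Avoids i v = Distinct v × (∀ k → lookup v k ≢ i)

avoids? : ∀ {r k} (i : Fin r) (v : Vec (Fin r) k) → Dec (Avoids i v)
avoids? i v = (FinP.all? λ k → FinP.all? λ l → (lookup v k Fin.≟ lookup v l) →-dec (k Fin.≟ l))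
  ×-dec (FinP.all? λ k → ¬? (lookup v k Fin.≟ i))

abstract
  triangle₆ : ∀ i → Avoids i (others₆ i) × Exceeds 25 (twinTriangle L₆ i (lookup (others₆ i))) whole
  triangle₆ = from-yes (FinP.all? λ i →
    avoids? i (others₆ i) ×-dec exceeds? 25 (twinTriangle L₆ i (lookup (others₆ i))) whole)

  triangle₄ : ∀ i → Avoids i (others₄ i) × Exceeds 25 (twinTriangle L₄ i (lookup (others₄ i))) whole
  triangle₄ = from-yes (FinP.all? λ i →
    avoids? i (others₄ i) ×-dec exceeds? 25 (twinTriangle L₄ i (lookup (others₄ i))) whole)

-- A cyclic triangle with a vertex dominating it.
diamond : Arcs 4
diamond = ext (ext (ext (λ (_ _ : Fin 1) → false) (λ _ → true)) (cons true (λ _ → false))) (λ _ → true)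

diamond-L₄ : Occurs L₄ diamond
-- Vertices 0, 1, 2 are already in transitive order; switching vertex 3 gives it the alternating
-- arcs of the last vertex of `L₄`.
diamond-L₄ = (λ i → i) , W , from-yes (switch diamond W ≟ᴬ L₄)
  where
  W : Fin 4 → Bool
  W i = does (i Fin.≟ # 3)

-- From one copy of R to a block decomposition

ext-cong : ∀ {k} {S S′ : Arcs k} {t t′} → (∀ i j → S i j ≡ S′ i j) → (∀ i → t i ≡ t′ i) →
  ∀ i j → ext S t i j ≡ ext S′ t′ i j
ext-cong p q zero    zero    = refl
ext-cong p q zero    (suc j) = q j
ext-cong p q (suc i) zero    = cong not (q i)
ext-cong p q (suc i) (suc j) = p i j

on-cons : ∀ {n k} {S : Arcs n} → IsTournament S → ∀ {v} {f : Fin k → Fin n} → (∀ i → f i ≢ v) →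
  ∀ i j → (S on cons v f) i j ≡ ext (S on f) (λ k → S v (f k)) i j
on-cons tS ne zero    zero    = proj₁ tS _
on-cons tS ne zero    (suc j) = refl
on-cons tS ne (suc i) zero    = proj₂ tS _ _ (ne i)
on-cons tS ne (suc i) (suc j) = refl

switch-xor : ∀ {n} {T : Arcs n} (W : Fin n → Bool) → IsTournament T → ∀ u v → u ≢ v →
  switch T W u v ≡ T u v xor (W u xor W v)
switch-xor {T = T} W t u v u≢v with W u xor W v
... | false = sym (𝔹P.xor-identityʳ (T u v))
... | true  = trans (proj₂ t v u (u≢v ∘ sym)) (sym (𝔹P.xor-comm (T u v) true))

-- Extends the switching of a copy to the whole tournament, with default `false` off the copy.
extend-along : ∀ {r n} {x : Fin r → Fin n} → Inj x → (f : Fin r → Bool) →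
  Σ (Fin n → Bool) λ g → ∀ i → g (x i) ≡ f i
extend-along {x = x} inj f = (λ v → from-search v (search v)) , λ i → at i (search (x i))
  where
  search = λ v → FinP.any? (λ j → v Fin.≟ x j)
  from-search : ∀ v → Dec (∃ λ j → v ≡ x j) → Bool
  from-search v (yes (j , _)) = f j
  from-search v (no _)        = false
  at : ∀ i d → from-search (x i) d ≡ f i
  at i (yes (j , eq)) = cong f (sym (inj eq))
  at i (no ¬eq)       = contradiction (i , refl) ¬eq

blocks-switch : ∀ {r n} {R : Arcs r} {T : Arcs n} W → Blocks R (switch T W) → Blocks R T
blocks-switch {T = T} W B = record
  { W = λ v → W v xor Blocks.W B v
  ; b = Blocks.b B
  ; across = λ u v ne → trans (sym (same u v)) (Blocks.across B u v ne)
  ; within = λ u v w uv vw p q → trans (sym (same u w))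
      (Blocks.within B u v w uv vw (trans (same u v) p) (trans (same v w) q))
  }
  where same = switch-switch T W (Blocks.W B)

-- The argument common to `L₆` and `L₄`. `Good` is a hereditary, switching-invariant property: a
-- determinant bound of 25 for `L₆`, and for `L₄` the same bound together with absence of `L₆`. The
-- finite checks enter as `one-vertex`, `two-vertices` and `triangle`.
module Structure {r} (R : Arcs r) (tR : IsTournament R)
  (Good : ∀ {k} → Arcs k → Set)
  (good-on : ∀ {k n} {T : Arcs n} (e : Fin k → Fin n) → Inj e → Good T → Good (T on e))
  (good-cong : ∀ {n} {S T : Arcs n} → (∀ u v → S u v ≡ T u v) → Good S → Good T)
  (good-switch : ∀ {n} {T : Arcs n} W → IsTournament T → Good T → Good (switch T W))
  (one-vertex : ∀ t → Good (ext R t) → TwinType R t)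
  (two-vertices : ∀ i j p q → i ≢ j → ¬ Good (wrongPair R i j p q))
  (others : Fin r → Vec (Fin r) 3)
  (avoids : ∀ i → Avoids i (others i))
  (triangle : ∀ i → ¬ Good (twinTriangle R i (lookup (others i))))
  where

  module _ {n} {S : Arcs n} (tS : IsTournament S) (good : Good S)
    {x : Fin r → Fin n} (inj : Inj x) (copy : ∀ i j → S (x i) (x j) ≡ R i j) where

    -- The field `home` pins each vertex of the copy to its own block, unswitched, so that switching
    -- by `W` preserves the copy.
    record Place (v : Fin n) : Set where
      field
        block : Fin r
        flips : Bool
        agree : ∀ j → j ≢ block → S v (x j) xor flips ≡ R block j
        home  : ∀ j → v ≡ x j → block ≡ j × flips ≡ false

    place : ∀ v → Place v
    place v with FinP.any? (λ j → v Fin.≟ x j)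
    ... | yes (i , refl) = record
      { block = i
      ; flips = false
      ; agree = λ j _ → trans (𝔹P.xor-identityʳ _) (copy i j)
      ; home  = λ j eq → inj eq , refl
      }
    ... | no v∉x = record
      { block = proj₁ type
      ; flips = proj₁ (proj₂ type)
      ; agree = proj₂ (proj₂ type)
      ; home  = λ j eq → contradiction (j , eq) v∉x
      }
      where
      ne : ∀ j → x j ≢ v
      ne j eq = v∉x (j , sym eq)
      type : TwinType R (λ j → S v (x j))
      type = one-vertex (λ j → S v (x j)) (good-cong
        (λ i j → trans (on-cons tS ne i j) (ext-cong copy (λ _ → refl) i j))
        (good-on (cons v x) (cons-injective inj ne) good))

    b : Fin n → Fin r
    b v = Place.block (place v)

    W : Fin n → Bool
    W v = Place.flips (place v)

    U : Arcs n
    U = switch S W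

    tU : IsTournament U
    tU = switch-tournament W tS

    goodU : Good U
    goodU = good-switch W tS good

    b-x : ∀ i → b (x i) ≡ i
    b-x i = proj₁ (Place.home (place (x i)) i refl)

    U-x : ∀ v j → b v ≢ j → U v (x j) ≡ R (b v) j
    U-x v j ne = trans (switch-xor W tS v (x j) (λ eq → ne (proj₁ (Place.home (place v) j eq)))) (trans
      (cong (λ c → S v (x j) xor (W v xor c)) (proj₂ (Place.home (place (x j)) j refl))) (trans
      (cong (S v (x j) xor_) (𝔹P.xor-identityʳ (W v)))
      (Place.agree (place v) j (ne ∘ sym))))

    U-copy : ∀ i j → U (x i) (x j) ≡ R i j
    U-copy i j with i Fin.≟ j
    ... | yes refl = trans (proj₁ tU (x i)) (sym (proj₁ tR i))
    ... | no i≢j   = subst (λ k → U (x i) (x j) ≡ R k j) (b-x i)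
      (U-x (x i) j (λ eq → i≢j (trans (sym (b-x i)) eq)))

    -- Only the arc between `v` and the copy vertex of its own block remains undetermined; it
    -- becomes the parameter of `twinRow`.
    U-twinRow : ∀ v k → U v (x k) ≡ twinRow R (b v) (U v (x (b v))) k
    U-twinRow v k with k Fin.≟ b v
    ... | yes eq = cong (λ j → U v (x j)) eq
    ... | no ne  = U-x v k (ne ∘ sym)

    -- If the arc disagreed with `R`, then `u`, `v` and the copy would form exactly a `wrongPair`.
    across-outer : ∀ u v → (∀ j → x j ≢ u) → (∀ j → x j ≢ v) → b u ≢ b v → U u v ≡ R (b u) (b v)
    across-outer u v u∉x v∉x ne with U u v 𝔹P.≟ R (b u) (b v)
    ... | yes eq = eq
    ... | no wrong = ⊥-elim (two-vertices (b u) (b v) (U u (x (b u))) (U v (x (b v))) ne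
      (good-cong shape (good-on (cons u (cons v x)) (cons-injective (cons-injective inj v∉x) u∉vx) goodU)))
      where
      u∉vx : ∀ i → cons v x i ≢ u
      u∉vx zero    eq = ne (cong b (sym eq))
      u∉vx (suc i) eq = u∉x i eq
      shape : ∀ i j → (U on cons u (cons v x)) i j ≡
        wrongPair R (b u) (b v) (U u (x (b u))) (U v (x (b v))) i j
      shape i j = trans (on-cons tU u∉vx i j) (ext-cong
        (λ i j → trans (on-cons tU v∉x i j) (ext-cong U-copy (U-twinRow v) i j))
        (λ { zero → 𝔹P.¬-not wrong ; (suc k) → U-twinRow u k }) i j)

    across : Across R U b
    across u v ne with FinP.any? (λ j → x j Fin.≟ v) | FinP.any? (λ j → x j Fin.≟ u)
    ... | yes (j , refl) | _ = trans (U-x u j (λ eq → ne (trans eq (sym (b-x j)))))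
      (cong (R (b u)) (sym (b-x j)))
    -- With only `u` in the copy, the arc is read from the side of `v` and reversed.
    ... | no _ | yes (i , refl) = begin
      U (x i) v              ≡⟨ proj₂ tU (x i) v (ne ∘ cong b) ⟩
      not (U v (x i))        ≡⟨ cong not (U-x v i (λ eq → ne (trans (b-x i) (sym eq)))) ⟩
      not (R (b v) i)        ≡⟨ cong (λ k → not (R (b v) k)) (sym (b-x i)) ⟩
      not (R (b v) (b (x i))) ≡⟨ sym (proj₂ tR (b (x i)) (b v) ne) ⟩
      R (b (x i)) (b v)      ∎
    ... | no v∉x | no u∉x =
      across-outer u v (λ j eq → u∉x (j , eq)) (λ j eq → v∉x (j , eq)) ne

    -- The three vertices of one block see the copy vertices of `others` alike, so together they
    -- form a `twinTriangle`.
    no-cycle : ∀ u v w → b u ≡ b v → b v ≡ b w → U u v ≡ true → U v w ≡ true → U w u ≡ true → ⊥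
    no-cycle u v w uv vw p q s = triangle (b u) (good-cong shape
      (good-on (cons u (cons v (cons w y)))
        (cons-injective (cons-injective (cons-injective y-inj w∉) v∉) u∉) goodU))
      where
      τ : Fin 3 → Fin r
      τ = lookup (others (b u))
      y : Fin 3 → Fin n
      y = x ∘ τ
      y-inj : Inj y
      y-inj eq = proj₁ (avoids (b u)) _ _ (inj eq)
      away : ∀ z → b u ≡ b z → ∀ k → y k ≢ z
      away z eq k e = proj₂ (avoids (b u)) k (trans (sym (b-x (τ k))) (trans (cong b e) (sym eq)))
      w∉ = away w (trans uv vw)
      arc⇒≢ : ∀ {a c} → U a c ≡ true → a ≢ c
      arc⇒≢ {a} ac refl = false≢true (proj₁ tU a) ac
      v∉ : ∀ k → cons w y k ≢ v
      v∉ zero    = arc⇒≢ q ∘ sym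
      v∉ (suc k) = away v uv k
      u∉ : ∀ k → cons v (cons w y) k ≢ u
      u∉ zero          = arc⇒≢ p ∘ sym
      u∉ (suc zero)    = arc⇒≢ s
      u∉ (suc (suc k)) = away u refl k
      row : ∀ z → b u ≡ b z → ∀ k → U z (y k) ≡ R (b u) (τ k)
      row z eq k = trans
        (U-x z (τ k) (λ e → proj₂ (avoids (b u)) k (trans (sym e) (sym eq))))
        (cong (λ i → R i (τ k)) (sym eq))
      shape : ∀ i j → (U on cons u (cons v (cons w y))) i j ≡ twinTriangle R (b u) τ i j
      shape i j = trans (on-cons tU u∉ i j) (ext-cong
        (λ i j → trans (on-cons tU v∉ i j) (ext-cong
          (λ i j → trans (on-cons tU w∉ i j)
            (ext-cong (λ k l → U-copy (τ k) (τ l)) (row w (trans uv vw)) i j))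
          (λ { zero → q ; (suc k) → row v uv k }) i j))
        (λ { zero → p ; (suc zero) → asym tU s ; (suc (suc k)) → row u refl k }) i j)

    -- A failure of transitivity would close either a cyclic triangle or, when `u` is `w`, a pair of
    -- opposite arcs.
    within : Within U b
    within u v w uv vw p q with U u w in uw
    ... | true  = refl
    ... | false with u Fin.≟ w
    ...   | yes refl = contradiction (trans (sym (asym tU p)) q) (λ ())
    ...   | no u≢w   = ⊥-elim (no-cycle u v w uv vw p q
      (trans (proj₂ tU w u (u≢w ∘ sym)) (cong not uw)))

    blocks : Blocks R S
    blocks = record { W = W ; b = b ; across = across ; within = within }

  -- The occurrence is first switched into an exact copy of `R`. Block `i` contains `x i`, which
  -- later makes all block sizes positive.
  structure : ∀ {n} {T : Arcs n} → IsTournament T → Good T → Occurs R T →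
    Σ (Blocks R T) λ B → ∀ i → ∃ λ v → Blocks.b B v ≡ i
  structure {n} {T} tT good occ@(x , W₀ , eq) =
    blocks-switch W₁ (blocks tS goodS inj copy) , λ i → x i , b-x tS goodS inj copy i
    where
    inj : Inj x
    inj = occurs-injective tR tT occ
    W₁ : Fin n → Bool
    W₁ = proj₁ (extend-along inj W₀)
    tS : IsTournament (switch T W₁)
    tS = switch-tournament W₁ tT
    goodS : Good (switch T W₁)
    goodS = good-switch W₁ tT good
    copy : ∀ i j → switch T W₁ (x i) (x j) ≡ R i j
    copy i j = trans
      (cong₂ (λ c d → if c xor d then T (x j) (x i) else T (x i) (x j))
        (proj₂ (extend-along inj W₀) i) (proj₂ (extend-along inj W₀) j))
      (eq i j)

-- Tournaments with and without L₆

bounded-exceeds : ∀ {k} {S : Arcs k} {vs : List (Candidate k)} → Any (Exceeds 25 S) vs → ¬ Bounded 25 S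
bounded-exceeds any bd with Any.satisfied any
... | c , exceeds = exceeds⇒¬bounded {c = c} exceeds bd

twinType-cong : ∀ {r} {R : Arcs r} {t t′ : Fin r → Bool} → (∀ i → t i ≡ t′ i) → TwinType R t → TwinType R t′
twinType-cong eq (i , s , p) = i , s , λ j ne → trans (cong (_xor s) (sym (eq j))) (p j ne)

one-vertex-bounded₆ : ∀ t → Bounded 25 (ext L₆ t) → TwinType L₆ t
one-vertex-bounded₆ t bd with one-vertex₆ (tabulate t)
... | inj₁ type = twinType-cong {R = L₆} (VecP.lookup∘tabulate t) type
... | inj₂ any  = ⊥-elim (exceeds⇒¬bounded {c = 5 , proj₁ (Any.satisfied any)} (proj₂ (Any.satisfied any))
  (bounded-cong (ext-cong (λ _ _ → refl) (λ i → sym (VecP.lookup∘tabulate t i))) bd))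

two-vertices-bounded₆ : ∀ i j p q → i ≢ j → ¬ Bounded 25 (wrongPair L₆ i j p q)
two-vertices-bounded₆ i j p q i≢j bd with two-vertices₆ i j p q
... | inj₁ i≡j = i≢j i≡j
... | inj₂ any = bounded-exceeds any bd

structure₆ : ∀ {n} {T : Arcs n} → IsTournament T → Bounded 25 T → Occurs L₆ T →
  Σ (Blocks L₆ T) λ B → ∀ i → ∃ λ v → Blocks.b B v ≡ i
structure₆ = structure
  where
  open Structure L₆ L₆-tournament (Bounded 25) (λ e → bounded-on) bounded-cong bounded-switch
    one-vertex-bounded₆ two-vertices-bounded₆ others₆ (λ i → proj₁ (triangle₆ i))
    (λ i → exceeds⇒¬bounded {c = whole} (proj₂ (triangle₆ i)))

occursAt⇒occurs : ∀ {r k} {R : Arcs (suc r)} {S : Arcs k} v → OccursAt R S v → Occurs R S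
occursAt⇒occurs {R = R} {S} v occ = lookup v , matchingSwitch R S v , OccursAt.copy occ

L₆-free : ∀ {k} → Arcs k → Set
L₆-free T = Bounded 25 T × ¬ Occurs L₆ T

two-vertices-free₄ : ∀ i j p q → i ≢ j → ¬ L₆-free (wrongPair L₄ i j p q)
two-vertices-free₄ i j p q i≢j (bd , ¬occ) = refute (two-vertices₄ i j p q)
  where
  refute : i ≡ j ⊎ Exceeds 25 (wrongPair L₄ i j p q) whole ⊎
    Any (OccursAt L₆ (wrongPair L₄ i j p q)) (permutations 6) → ⊥
  refute (inj₁ i≡j)            = i≢j i≡j
  refute (inj₂ (inj₁ exceeds)) = exceeds⇒¬bounded {c = whole} exceeds bd
  refute (inj₂ (inj₂ any))     = let v , occ = Any.satisfied any
    in ¬occ (occursAt⇒occurs {R = L₆} {wrongPair L₄ i j p q} v occ)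

structure₄ : ∀ {n} {T : Arcs n} → IsTournament T → L₆-free T → Occurs L₄ T → Blocks L₄ T
structure₄ tT free occ = proj₁ (structure tT free occ)
  where
  open Structure L₄ L₄-tournament L₆-free
    (λ {_} {_} {T} e inj (bd , ¬occ) → bounded-on inj bd , ¬occ ∘ occurs-on {R = L₆} {T} e)
    (λ {_} {S} {T} eq (bd , ¬occ) →
      bounded-cong eq bd , ¬occ ∘ occurs-cong {R = L₆} {T} {S} (λ u v → sym (eq u v)))
    (λ {_} {T} W t (bd , ¬occ) → bounded-switch W t bd , ¬occ ∘ occurs-switch {R = L₆} {T} W)
    (λ t _ → twinType-cong {R = L₄} (VecP.lookup∘tabulate t) (one-vertex₄ (tabulate t)))
    two-vertices-free₄ others₄ (λ i → proj₁ (triangle₄ i))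
    (λ i (bd , _) → exceeds⇒¬bounded {c = whole} (proj₂ (triangle₄ i)) bd)

-- Its blowups are the transitive tournaments, so `Blocks point T` says that `T` is switching
-- equivalent to a transitive one.
point : Arcs 1
point _ _ = false

-- Switch so that the first vertex dominates all others.
structure₁ : ∀ {n} {T : Arcs n} → IsTournament T → ¬ Occurs L₄ T → Blocks point T
structure₁ {zero} _ _ = record
  { W = λ () ; b = λ () ; across = λ () ; within = λ () }
structure₁ {suc n} {T} tT ¬occ = record
  { W = W
  ; b = λ _ → zero
  ; across = λ _ _ ne → contradiction refl ne
  ; within = λ u v w _ _ → transitive u v w
  }
  where
  W : Fin (suc n) → Bool
  W v = T v zero
  S : Arcs (suc n)
  S = switch T W
  tS : IsTournament S
  tS = switch-tournament W tT
  dominates : ∀ v → v ≢ zero → S zero v ≡ true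
  dominates v v≢0 = begin
    S zero v                                  ≡⟨ switch-xor W tT zero v (v≢0 ∘ sym) ⟩
    T zero v xor (T zero zero xor T v zero)   ≡⟨ cong₂ (λ a c → a xor (c xor T v zero))
                                                   (proj₂ tT zero v (v≢0 ∘ sym)) (proj₁ tT zero) ⟩
    not (T v zero) xor T v zero               ≡⟨ complement (T v zero) ⟩
    true                                      ∎
    where
    complement : ∀ c → not c xor c ≡ true
    complement true  = refl
    complement false = refl
  arc⇒≢ : ∀ {u v} → S u v ≡ true → u ≢ v
  arc⇒≢ {u} uv refl = false≢true (proj₁ tS u) uv
  into⇒≢0 : ∀ {u v} → S u v ≡ true → v ≢ zero
  into⇒≢0 {u} uv refl = false≢true (asym tS uv) (dominates u (arc⇒≢ uv))
  -- Vertex 0 has no in-arcs in `S`, so it lies outside any cyclic triangle and dominates it; the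
  -- four vertices form a `diamond`, a switched `L₄`.
  no-cycle : ∀ u v w → S u v ≡ true → S v w ≡ true → S w u ≡ true → ⊥
  no-cycle u v w uv vw wu = ¬occ (occurs-switch {R = L₄} {T} W (occurs-on {R = L₄} {S} e
    (occurs-cong {R = L₄} {diamond} {S on e} (λ i j → sym (shape i j)) diamond-L₄)))
    where
    e : Fin 4 → Fin (suc n)
    e = cons zero (cons u (cons v (λ (_ : Fin 1) → w)))
    v∉ : ∀ (k : Fin 1) → w ≢ v
    v∉ _ = arc⇒≢ vw ∘ sym
    u∉ : ∀ k → cons v (λ (_ : Fin 1) → w) k ≢ u
    u∉ zero    = arc⇒≢ uv ∘ sym
    u∉ (suc _) = arc⇒≢ wu
    0∉ : ∀ k → cons u (cons v (λ (_ : Fin 1) → w)) k ≢ zero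
    0∉ zero          = into⇒≢0 wu
    0∉ (suc zero)    = into⇒≢0 uv
    0∉ (suc (suc _)) = into⇒≢0 vw
    shape : ∀ i j → (S on e) i j ≡ diamond i j
    shape i j = trans (on-cons tS 0∉ i j) (ext-cong
      (λ i j → trans (on-cons tS u∉ i j) (ext-cong
        (λ i j → trans (on-cons tS v∉ i j) (ext-cong (λ _ _ → proj₁ tS w) (λ _ → vw) i j))
        (λ { zero → uv ; (suc _) → asym tS wu }) i j))
      (λ k → dominates _ (0∉ k)) i j)
  transitive : ∀ u v w → S u v ≡ true → S v w ≡ true → S u w ≡ true
  transitive u v w uv vw with S u w in uw
  ... | true  = refl
  ... | false with u Fin.≟ w
  ...   | yes refl = contradiction (trans (sym (asym tS uv)) vw) (λ ())
  ...   | no u≢w   = ⊥-elim (no-cycle u v w uv vw (trans (proj₂ tS w u (u≢w ∘ sym)) (cong not uw)))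

point-tournament : IsTournament point
point-tournament = (λ _ → refl) , λ { zero zero ne → contradiction refl ne }

point-bounded : IncreasingBounded 9 point
point-bounded = from-yes (increasingBounded? 9 point)

-- Either way `T` is a switched blowup of a tournament, `L₄` or `point`, whose own subdeterminants
-- are at most 9.
L₆-free⇒bounded : ∀ {n} {T : Arcs n} → IsTournament T → L₆-free T → Bounded 9 T
L₆-free⇒bounded {T = T} tT free = by-cases (occurs? L₄ T)
  where
  by-cases : Dec (Occurs L₄ T) → Bounded 9 T
  by-cases (yes occ) =
    blocks-bounded L₄-tournament tT (increasingBounded⇒ L₄ L₄-bounded) (structure₄ tT free occ)
  by-cases (no ¬occ) =
    blocks-bounded point-tournament tT (increasingBounded⇒ point point-bounded) (structure₁ tT ¬occ)

-- The two directions of the equivalence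

exceptional⇒blowup : ∀ {n} {T : Arcs n} → IsTournament T → InD 5 T → ¬ InD 3 T → SwitchEquivBlowupL₆ T
exceptional⇒blowup {T = T} tT inD₅ ¬inD₃ = by-cases (occurs? L₆ T)
  where
  bd : Bounded 25 T
  bd = InD⇒Bounded 5 inD₅
  assemble : (Σ (Blocks L₆ T) λ B → ∀ i → ∃ λ v → Blocks.b B v ≡ i) → SwitchEquivBlowupL₆ T
  assemble (B , onto) =
    let a , nonempty , iso = blocks⇒blowup tT B
    in Blocks.W B , a ,
       (λ i → subst (λ k → 1 ℕ.≤ a k) (proj₂ (onto i)) (nonempty (proj₁ (onto i)))) , iso
  by-cases : Dec (Occurs L₆ T) → SwitchEquivBlowupL₆ T
  -- Without `L₆` all subdeterminants would be at most 9, against the assumption.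
  by-cases (no ¬occ) = contradiction (Bounded⇒InD 3 (L₆-free⇒bounded tT (bd , ¬occ))) ¬inD₃
  by-cases (yes occ) = assemble (structure₆ tT bd occ)

blowup⇒InD₅ : ∀ {n} {T : Arcs n} → IsTournament T → SwitchEquivBlowupL₆ T → InD 5 T
blowup⇒InD₅ tT (W , a , _ , iso) = Bounded⇒InD 5
  (blocks-bounded L₆-tournament tT (increasingBounded⇒ L₆ L₆-bounded) (blowup⇒blocks W a iso))

-- One vertex from each block, available because every `a i` is positive, gives a copy of `L₆` in
-- the switch.
blowup⇒¬InD₃ : ∀ {n} {T : Arcs n} → IsTournament T → SwitchEquivBlowupL₆ T → ¬ InD 3 T
blowup⇒¬InD₃ {n} {T} tT (W , a , 1≤a , φ , eq) inD₃ = exceeds⇒¬bounded {c = whole} L₆-exceeds-9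
  (bounded-cong copy (bounded-on inj (bounded-switch W tT (InD⇒Bounded 3 inD₃))))
  where
  open Inverse φ using (to; from; strictlyInverseˡ)
  first : ∀ {m} → 1 ℕ.≤ m → Fin m
  first (s≤s _) = zero
  vertex : Fin 6 → Fin n
  vertex i = from (i , first (1≤a i))
  block : ∀ i → proj₁ (to (vertex i)) ≡ i
  block i = cong proj₁ (strictlyInverseˡ (i , first (1≤a i)))
  inj : Inj vertex
  inj {i} {j} e = trans (sym (block i)) (trans (cong (proj₁ ∘ to) e) (block j))
  copy : ∀ i j → switch T W (vertex i) (vertex j) ≡ L₆ i j
  copy i j with i Fin.≟ j
  ... | yes refl = trans (proj₁ (switch-tournament W tT) (vertex i)) (sym (proj₁ L₆-tournament i))
  ... | no i≢j   = trans (eq (vertex i) (vertex j)) (trans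
    (blowup-across L₆ a (to (vertex i)) (to (vertex j))
      (λ e → i≢j (trans (sym (block i)) (trans e (block j)))))
    (cong₂ L₆ (block i) (block j)))

theorem3p11 : (n : ℕ) (T : Fin n → Fin n → Bool) → IsTournament T →
    (InD 5 T × ¬ InD 3 T) ⇔ SwitchEquivBlowupL₆ T
theorem3p11 n T tT = mk⇔
  (λ (inD₅ , ¬inD₃) → exceptional⇒blowup tT inD₅ ¬inD₃)
  (λ blown → blowup⇒InD₅ tT blown , blowup⇒¬InD₃ tT blown)
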